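{- Let $n\ge 16$ be even and let $W_{4,n}$ be the $4$-regular Kn\"odel graph. Then $W_{4,n}$ is $\gamma$-critical if and only if (i) $n=26$, or (ii) $n\ge 22$ and $n\equiv 2\pmod{10}$, or (iii) $n\ge 38$ and $n\equiv 8\pmod{10}$.
   Context: For an even integer $n\ge 2$ and $1\le\Delta\le\lfloor\log_2 n\rfloor$, the Kn\"odel graph $W_{\Delta,n}$ is the $\Delta$-regular bipartite graph on the $n$ vertices $(i,j)$, $i\in\{1,2\}$, $0\le j\le n/2-1$, in which for every $j$ the vertex $(1,j)$ is adjacent to the vertices $(2,(j+2^k-1)\bmod (n/2))$ for $k=0,1,\dots,\Delta-1$ (and there are no other edges). A set $D$ of vertices of a graph $G$ is dominating if every vertex not in $D$ is adjacent to a vertex of $D$; $\gamma(G)$ is the minimum size of a dominating set. A graph $G$ is $\gamma$-critical if $\gamma(G-u)<\gamma(G)$ for every vertex $u$ of $G$, where $G-u$ is the graph obtained by deleting $u$. -}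

module Defs where

open import Data.Empty using (⊥)
open import Data.Fin using (Fin; toℕ)
open import Data.Fin.Patterns using (0F; 1F)
open import Data.Fin.Properties using (nonZeroIndex)
open import Data.List using (List; length)
open import Data.List.Membership.Propositional using (_∈_; _∉_)
open import Data.List.Relation.Unary.Unique.Propositional using (Unique)
open import Data.Nat using (ℕ; _+_; _∸_; _^_; _≤_; _<_; _/_; _%_)
open import Data.Product using (∃; ∃₂; ∃-syntax; _×_; _,_)
open import Data.Refinement using (Refinement-syntax; value)
open import Relation.Binary.PropositionalEquality using (_≡_; _≢_)
open import Relation.Nullary using (¬_)

record Graph : Set₁ where
  field
    Vertex     : Set
    Adj        : Vertex → Vertex → Set
    Adj-sym    : ∀ {x y} → Adj x y → Adj y x
    Adj-irrefl : ∀ {x} → ¬ Adj x x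

open Graph public

-- Deletion of a vertex. The proof that x ≢ u is irrelevant in a refinement
-- type, so each vertex other than u gives exactly one vertex of delete G u.
delete : (G : Graph) → Vertex G → Graph
delete G u = record
  { Vertex     = [ x ∈ Vertex G ∣ x ≢ u ]
  ; Adj        = λ x y → Adj G (value x) (value y)
  ; Adj-sym    = Adj-sym G
  ; Adj-irrefl = Adj-irrefl G
  }

-- A set of vertices is a duplicate-free list, whose size is its length.
IsDominating : (G : Graph) → List (Vertex G) → Set
IsDominating G D =
  Unique D × (∀ v → v ∉ D → ∃[ w ] (w ∈ D × Adj G v w))

-- IsDominationNumber G k means γ(G) = k.
IsDominationNumber : Graph → ℕ → Set
IsDominationNumber G k =
  (∃[ D ] (IsDominating G D × length D ≡ k)) ×
  (∀ D → IsDominating G D → k ≤ length D)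

γ-Critical : Graph → Set
γ-Critical G = ∀ (u : Vertex G) → ∃₂ λ a b →
  IsDominationNumber (delete G u) a × IsDominationNumber G b × a < b

-- The part labels 1 and 2 are 0F and 1F here. The usual standing assumptions
-- are that n ≥ 2 is even and 1 ≤ Δ ≤ ⌊log₂ n⌋; the definition itself does not
-- need them, since an index j : Fin (n / 2) already makes n / 2 nonzero.
KnödelVertex : ℕ → Set
KnödelVertex n = Fin 2 × Fin (n / 2)

KnödelEdge : (Δ n : ℕ) → Fin (n / 2) → Fin (n / 2) → Set
KnödelEdge Δ n j j′ = ∃ λ (k : Fin Δ) →
  toℕ j′ ≡ ((toℕ j + (2 ^ toℕ k ∸ 1)) % (n / 2)) {{nonZeroIndex j}}

KnödelAdj : (Δ n : ℕ) → KnödelVertex n → KnödelVertex n → Set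
KnödelAdj Δ n (0F , j) (1F , j′) = KnödelEdge Δ n j j′
KnödelAdj Δ n (1F , j′) (0F , j) = KnödelEdge Δ n j j′
KnödelAdj Δ n (0F , _) (0F , _)  = ⊥
KnödelAdj Δ n (1F , _) (1F , _)  = ⊥

W : (Δ n : ℕ) → Graph
W Δ n = record
  { Vertex     = KnödelVertex n
  ; Adj        = KnödelAdj Δ n
  ; Adj-sym    = λ {x} {y} → symm x y
  ; Adj-irrefl = λ {x} → irrefl x
  }
  where
  symm : ∀ x y → KnödelAdj Δ n x y → KnödelAdj Δ n y x
  symm (0F , _) (1F , _) e = e
  symm (1F , _) (0F , _) e = e
  symm (0F , _) (0F , _) ()
  symm (1F , _) (1F , _) ()

  irrefl : ∀ x → ¬ KnödelAdj Δ n x x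
  irrefl (0F , _) ()
  irrefl (1F , _) ()

{-# OPTIONS --safe #-}
module Submission where

-- Let m = n / 2 = 5t + r. A set with a vertices in part 1 and b in part 2 dominates part 1 a + 4b times and
-- part 2 4a + b times, counting multiplicity, so a domination number below the claimed one leaves only a
-- bounded total excess over covering each vertex once. Moreover 5a or 5b differs from m, so averaging over
-- the windows of five consecutive positions yields one with two chosen vertices of a part, or with none. Near such
-- an irregularity every way of dominating the neighbouring vertices exceeds the excess: this is local, and is
-- settled by a verified branch search, once for all m ≥ 34 and modulo m for each smaller m. The sets that
-- attain the bounds are periodic with period five apart from a bounded defect, and those missing exactly
-- one vertex are moved around by the automorphisms j ↦ c + j and (1 , j) ↔ (2 , − j).

open import Defs
open import Data.Bool using (Bool; true; false; if_then_else_; _∧_; _∨_; not; T)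
open import Data.Empty using (⊥)
open import Data.Fin using (Fin; toℕ)
open import Data.Fin.Patterns using (0F; 1F; 2F; 3F)
open import Data.Fin.Properties using (toℕ-injective; toℕ-fromℕ<; toℕ<n)
import Data.Fin.Properties as Fin
open import Data.Irrelevant using ([_])
open import Data.List using (List; []; _∷_; _++_; concatMap; deduplicate; drop; length; map; take; upTo)
import Data.List.Membership.DecPropositional as DecMembership
open import Data.List.Membership.Propositional using (_∈_; _∉_)
open import Data.List.Membership.Propositional.Properties using (∈-deduplicate⁺; ∈-map⁺)
open import Data.List.Properties using (length-deduplicate; length-map)
open import Data.List.Relation.Unary.All using (All; []; _∷_)
import Data.List.Relation.Unary.All as All
open import Data.List.Relation.Unary.All.Properties using (¬Any⇒All¬)
open import Data.List.Relation.Unary.Any using (here; there)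
open import Data.List.Relation.Unary.Unique.DecPropositional.Properties using (deduplicate-!)
open import Data.Maybe using (Maybe; just; nothing)
open import Data.Nat
open import Data.Nat.DivMod
open import Data.Nat.Divisibility using (_∣_; divides)
open import Data.Nat.ListAction using (sum)
open import Data.Nat.Properties hiding (_≟_)
open import Algebra.Properties.CommutativeSemigroup +-commutativeSemigroup using (interchange; x∙yz≈y∙xz)
open import Data.Nat.Tactic.RingSolver using (solve-∀)
open import Data.Product using (_×_; _,_; proj₁; proj₂; ∃; ∃₂; ∃-syntax)
open import Data.Product.Properties using (≡-dec)
import Data.Refinement as Refinement
open Refinement using (value)
open import Data.Sum using (_⊎_; inj₁; inj₂)
open import Data.Unit using (⊤; tt)
open import Function using (_∘_; id)
open import Function.Bundles using (_⇔_; mk⇔)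
open import Relation.Binary.Definitions using (DecidableEquality; tri<; tri≈; tri>)
open import Relation.Binary.PropositionalEquality
open import Relation.Nullary using (¬_; contradiction; no; yes)
open import Relation.Nullary.Decidable using (False; True; toWitness; toWitnessFalse)
open import Relation.Nullary.Recomputable using (¬-recompute)

-- Five enters because the offsets 0, 1, 3, 7 are 0, 1, 3, 2 modulo 5: if 5 divides m, one residue
-- class in part 1 together with the preceding class in part 2 dominates every vertex exactly once.
-- For large t the domination number is 2t, 2t+2, 2t+2, 2t+3, 2t+4 for r = 0, 1, 2, 3, 4, and
-- deleting a vertex saves one exactly for r = 1 and r = 4. The orders m = 8, 9, 13, 14, 18 depart
-- from this pattern; they account for the threshold 38 and the exception n = 26. Counting alone
-- cannot give these values, since it leaves a positive excess, up to 5 in one part. So small an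
-- excess means that almost every vertex is covered exactly once, which is very rigid, and the
-- search starts at a place where the five-periodic pattern must break. Critical orders need a lower
-- bound for full domination, the others one for domination with a hole; the same search serves
-- both, with the hole as an option that can be used once.

-- Finite sums, averaging and periodic functions.

∑ : ℕ → (ℕ → ℕ) → ℕ
∑ zero    f = 0
∑ (suc n) f = f n + ∑ n f

∑-mono : ∀ n {f g : ℕ → ℕ} → (∀ {i} → i < n → f i ≤ g i) → ∑ n f ≤ ∑ n g
∑-mono zero    f≤g = z≤n
∑-mono (suc n) f≤g = +-mono-≤ (f≤g ≤-refl) (∑-mono n (λ i<n → f≤g (m<n⇒m<1+n i<n)))

∑-cong : ∀ n {f g : ℕ → ℕ} → (∀ i → f i ≡ g i) → ∑ n f ≡ ∑ n g
∑-cong zero    f≗g = refl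
∑-cong (suc n) f≗g = cong₂ _+_ (f≗g n) (∑-cong n f≗g)

∑-+ : ∀ n (f g : ℕ → ℕ) → ∑ n (λ i → f i + g i) ≡ ∑ n f + ∑ n g
∑-+ zero    f g = refl
∑-+ (suc n) f g = trans (cong (f n + g n +_) (∑-+ n f g)) (interchange (f n) (g n) (∑ n f) (∑ n g))

∑-const : ∀ n c → ∑ n (λ _ → c) ≡ n * c
∑-const zero    c = refl
∑-const (suc n) c = cong (c +_) (∑-const n c)

∑-prefix : ∀ {l n} (f : ℕ → ℕ) → l ≤ n → ∑ l f ≤ ∑ n f
∑-prefix {n = zero}  f z≤n = z≤n
∑-prefix {l} {suc n} f l≤ with m≤n⇒m<n∨m≡n l≤
... | inj₁ (s≤s l≤n) = ≤-trans (∑-prefix f l≤n) (m≤n+m _ (f n))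
... | inj₂ refl = ≤-refl

∑-suc : ∀ n (f : ℕ → ℕ) → ∑ n (f ∘ suc) + f 0 ≡ ∑ n f + f n
∑-suc zero    f = refl
∑-suc (suc n) f = begin
  f (suc n) + ∑ n (f ∘ suc) + f 0   ≡⟨ +-assoc (f (suc n)) _ _ ⟩
  f (suc n) + (∑ n (f ∘ suc) + f 0) ≡⟨ cong (f (suc n) +_) (∑-suc n f) ⟩
  f (suc n) + (∑ n f + f n)         ≡⟨ +-comm (f (suc n)) _ ⟩
  ∑ n f + f n + f (suc n)           ≡⟨ cong (_+ f (suc n)) (+-comm (∑ n f) (f n)) ⟩
  f n + ∑ n f + f (suc n)           ∎
  where open ≡-Reasoning

-- Advancing the start by one drops a term and adds the equal term one period later.
∑-shift : ∀ n (f : ℕ → ℕ) → (∀ i → f (i + n) ≡ f i) → ∀ p → ∑ n (λ i → f (p + i)) ≡ ∑ n f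
∑-shift n f per zero    = refl
∑-shift n f per (suc p) = trans (+-cancelʳ-≡ (f (p + 0)) _ _ (begin
  ∑ n (λ i → f (suc p + i)) + f (p + 0) ≡⟨ cong (_+ f (p + 0)) (∑-cong n (λ i → cong f (sym (+-suc p i)))) ⟩
  ∑ n (λ i → f (p + suc i)) + f (p + 0) ≡⟨ ∑-suc n (λ i → f (p + i)) ⟩
  ∑ n (λ i → f (p + i)) + f (p + n)     ≡⟨ cong (∑ n (λ i → f (p + i)) +_) (trans (per p) (cong f (sym (+-identityʳ p)))) ⟩
  ∑ n (λ i → f (p + i)) + f (p + 0)     ∎))
  (∑-shift n f per p)
  where open ≡-Reasoning

-- The gap between ∑ n f and ∑ n g is at least the gap at a single index.
∑-jump : ∀ n {f g : ℕ → ℕ} {x i} → (∀ j → f j ≤ g j) → i < n → x + f i ≤ g i → x + ∑ n f ≤ ∑ n g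
∑-jump (suc n) {f} {g} {x} f≤g i<1+n gap with m≤n⇒m<n∨m≡n (s≤s⁻¹ i<1+n)
... | inj₂ refl = ≤-trans (≤-reflexive (sym (+-assoc x _ _))) (+-mono-≤ gap (∑-mono n (λ {j} _ → f≤g j)))
... | inj₁ i<n = ≤-trans (≤-reflexive (x∙yz≈y∙xz x (f n) (∑ n f)))
                 (+-mono-≤ (f≤g n) (∑-jump n f≤g i<n gap))

∃-above-average : ∀ n (f : ℕ → ℕ) c → n * c < ∑ n f → ∃[ i ] c < f i
∃-above-average (suc n) f c lt with c <? f n
... | yes c<fn = n , c<fn
... | no  c≮fn = ∃-above-average n f c (+-cancelˡ-< c _ _ (<-≤-trans lt (+-monoˡ-≤ (∑ n f) (≮⇒≥ c≮fn))))

∃-below-average : ∀ n (f : ℕ → ℕ) c → ∑ n f < n * c → ∃[ i ] f i < c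
∃-below-average (suc n) f c lt with f n <? c
... | yes fn<c = n , fn<c
... | no  fn≮c = ∃-below-average n f c (+-cancelˡ-< c _ _ (≤-<-trans (+-monoˡ-≤ (∑ n f) (≮⇒≥ fn≮c)) lt))

∑-swap : ∀ n k (f : ℕ → ℕ → ℕ) → ∑ n (λ i → ∑ k (f i)) ≡ ∑ k (λ j → ∑ n (λ i → f i j))
∑-swap n zero    f = trans (∑-const n 0) (*-zeroʳ n)
∑-swap n (suc k) f = trans (∑-+ n (λ i → f i k) (λ i → ∑ k (f i))) (cong (∑ n (λ i → f i k) +_) (∑-swap n k f))

∑-≥1 : ∀ n f {i} → i < n → 0 < f i → 0 < ∑ n f
∑-≥1 n f {i} i<n 0<fi = ≤-trans (m≤m+n 1 _) (∑-jump n {f = λ _ → 0} {i = i} (λ _ → z≤n) i<n 0<fi)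

∑-≥2 : ∀ n f {i j} → i < j → j < n → 0 < f i → 0 < f j → 1 < ∑ n f
∑-≥2 (suc n) f i<j j<1+n 0<fi 0<fj with m≤n⇒m<n∨m≡n (s≤s⁻¹ j<1+n)
... | inj₁ j<n  = ≤-trans (∑-≥2 n f i<j j<n 0<fi 0<fj) (m≤n+m _ (f n))
... | inj₂ refl = +-mono-≤ 0<fj (∑-≥1 n f i<j 0<fi)

∑>0 : ∀ n f → 0 < ∑ n f → ∃[ i ] (i < n × 0 < f i)
∑>0 (suc n) f lt with f n in eq
... | suc _ = n , ≤-refl , subst (0 <_) (sym eq) z<s
... | zero  = let i , i<n , p = ∑>0 n f lt in i , m<n⇒m<1+n i<n , p

∑>1 : ∀ n f → (∀ i → f i ≤ 1) → 1 < ∑ n f → ∃₂ λ i j → i < j × j < n × 0 < f i × 0 < f j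
∑>1 (suc n) f bit lt with f n in eq | bit n
... | zero        | _ = let i , j , i<j , j<n , p = ∑>1 n f bit lt in i , j , i<j , m<n⇒m<1+n j<n , p
... | suc zero    | _ = let i , i<n , p = ∑>0 n f (s≤s⁻¹ lt) in i , n , i<n , ≤-refl , p , subst (0 <_) (sym eq) z<s
... | suc (suc _) | s≤s ()

∑≡0 : ∀ n f {i} → ∑ n f < 1 → i < n → f i ≡ 0
∑≡0 n f {i} lt i<n with f i in eq
... | zero  = refl
... | suc _ = contradiction (≤-trans (∑-≥1 n f i<n (subst (0 <_) (sym eq) z<s)) (s≤s⁻¹ lt)) λ ()

periodic-* : ∀ {m} {f : ℕ → ℕ} → (∀ i → f (i + m) ≡ f i) → ∀ q i → f (i + q * m) ≡ f i
periodic-* {m} {f} per zero    i = cong f (+-identityʳ i)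
periodic-* {m} {f} per (suc q) i = trans (cong f (sym (+-assoc i m (q * m)))) (trans (periodic-* per q (i + m)) (per i))

periodic-% : ∀ {m} .{{_ : NonZero m}} {f : ℕ → ℕ} → (∀ i → f (i + m) ≡ f i) → ∀ i → f (i % m) ≡ f i
periodic-% {m} {f} per i = trans (sym (periodic-* per (i / m) (i % m))) (cong f (sym (m≡m%n+[m/n]*n i m)))

-- Positions, closed neighbourhoods and coverage.

Position : Set
Position = Fin 2 × ℕ

-- Offsets from i of the closed neighbourhood of the vertex i of part 1, respectively 7 + i of part 2;
-- the shift by 7 = 2 ^ 3 ∸ 1 keeps them nonnegative.
reach : Fin 2 → List (Fin 2 × ℕ)
reach 0F = (0F , 0) ∷ (1F , 0) ∷ (1F , 1) ∷ (1F , 3) ∷ (1F , 7) ∷ []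
reach 1F = (1F , 7) ∷ (0F , 7) ∷ (0F , 6) ∷ (0F , 4) ∷ (0F , 0) ∷ []

coverage : (Fin 2 → ℕ → ℕ) → Fin 2 → ℕ → ℕ
coverage χ s i = sum (map (λ (t , d) → χ t (d + i)) (reach s))

_==_ : Position → Position → Bool
(0F , i) == (0F , j) = i ≡ᵇ j
(1F , i) == (1F , j) = i ≡ᵇ j
(0F , _) == (1F , _) = false
(1F , _) == (0F , _) = false

≡ᵇ-true : ∀ i j → (i ≡ᵇ j) ≡ true → i ≡ j
≡ᵇ-true i j eq = ≡ᵇ⇒≡ i j (subst T (sym eq) tt)

≡ᵇ-refl : ∀ i → (i ≡ᵇ i) ≡ true
≡ᵇ-refl zero    = refl
≡ᵇ-refl (suc i) = ≡ᵇ-refl i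

<ᵇ-true : ∀ i j → (i <ᵇ j) ≡ true → i < j
<ᵇ-true i j eq = <ᵇ⇒< i j (subst T (sym eq) tt)

<ᵇ-false : ∀ i j → (i <ᵇ j) ≡ false → j ≤ i
<ᵇ-false i       zero    eq = z≤n
<ᵇ-false (suc i) (suc j) eq = s≤s (<ᵇ-false i j eq)

==-true : ∀ v w → (v == w) ≡ true → v ≡ w
==-true (0F , i) (0F , j) eq = cong (0F ,_) (≡ᵇ-true i j eq)
==-true (1F , i) (1F , j) eq = cong (1F ,_) (≡ᵇ-true i j eq)
==-true (0F , _) (1F , _) ()
==-true (1F , _) (0F , _) ()

==-refl : ∀ v → (v == v) ≡ true
==-refl (0F , i) = ≡ᵇ-refl i
==-refl (1F , i) = ≡ᵇ-refl i

member : Position → List Position → Bool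
member v []      = false
member v (w ∷ P) = if v == w then true else member v P

indicator : Bool → ℕ
indicator b = if b then 1 else 0

count : List Position → List Position → ℕ
count P []       = 0
count P (v ∷ vs) = indicator (member v P) + count P vs

if-true : ∀ {b x y : Bool} → (if b then x else y) ≡ true →
          (b ≡ true × x ≡ true) ⊎ (b ≡ false × y ≡ true)
if-true {true}  p = inj₁ (refl , p)
if-true {false} p = inj₂ (refl , p)

not-true : ∀ {x} → not x ≡ true → x ≡ false
not-true {false} _ = refl

∧-true : ∀ {x y} → x ∧ y ≡ true → x ≡ true × y ≡ true
∧-true {true} {true} refl = refl , refl

member-there : ∀ v u P → indicator (member v P) ≤ indicator (member v (u ∷ P))
member-there v u P with v == u | member v P
... | true  | true  = ≤-refl
... | true  | false = z≤n
... | false | _     = ≤-refl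

count-mono : ∀ v P cs → count P cs ≤ count (v ∷ P) cs
count-mono v P []       = z≤n
count-mono v P (c ∷ cs) = +-mono-≤ (member-there c v P) (count-mono v P cs)

count-∷ : ∀ v P cs → member v P ≡ false → indicator (member v cs) + count P cs ≤ count (v ∷ P) cs
count-∷ v P []       v∉P = z≤n
count-∷ v P (c ∷ cs) v∉P with v == c in eq
... | true rewrite sym (==-true v c eq) | v∉P | ==-refl v = s≤s (count-mono v P cs)
... | false = begin
  indicator (member v cs) + (indicator (member c P) + count P cs) ≡⟨ x∙yz≈y∙xz (indicator (member v cs)) (indicator (member c P)) (count P cs) ⟩
  indicator (member c P) + (indicator (member v cs) + count P cs) ≤⟨ +-mono-≤ (member-there c v P) (count-∷ v P cs v∉P) ⟩
  count (v ∷ P) (c ∷ cs)                                          ∎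
  where
  open ≤-Reasoning

count≡0⇒∉ : ∀ P cs → count P cs ≡ 0 → All (λ v → member v P ≡ false) cs
count≡0⇒∉ P []       eq = []
count≡0⇒∉ P (c ∷ cs) eq with member c P in c∉P
... | false = c∉P ∷ count≡0⇒∉ P cs eq

<ᵇ0-false : ∀ n → (0 <ᵇ n) ≡ false → n ≡ 0
<ᵇ0-false n eq = n≤0⇒n≡0 (<ᵇ-false 0 n eq)

elem : ℕ → List ℕ → Bool
elem i []       = false
elem i (j ∷ js) = if i ≡ᵇ j then true else elem i js

-- Entries that are repeated or out of range do not count.
gain : ℕ → (ℕ → ℕ) → List ℕ → ℕ
gain l f []       = 0
gain l f (i ∷ is) = (if i <ᵇ l then (if elem i is then 0 else f i) else 0) + gain l f is

module _ (l : ℕ) {f a b : ℕ → ℕ} (f+a≤b : ∀ i → f i + a i ≤ b i) where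

  private
    mixed : List ℕ → ℕ → ℕ
    mixed is i = if elem i is then b i else a i

    mixed-∷ : ∀ i is j → mixed is j ≤ mixed (i ∷ is) j
    mixed-∷ i is j with j ≡ᵇ i | elem j is
    ... | true  | true  = ≤-refl
    ... | true  | false = m+n≤o⇒n≤o (f j) (f+a≤b j)
    ... | false | _     = ≤-refl

    gain-mixed : ∀ is → gain l f is + ∑ l a ≤ ∑ l (mixed is)
    gain-mixed []       = ≤-refl
    gain-mixed (i ∷ is) with i <ᵇ l in i<l
    ... | false = ≤-trans (gain-mixed is) (∑-mono l (λ {j} _ → mixed-∷ i is j))
    ... | true with elem i is in i∉is
    ...   | true  = ≤-trans (gain-mixed is) (∑-mono l (λ {j} _ → mixed-∷ i is j))
    ...   | false = ≤-trans (≤-reflexive (+-assoc (f i) _ _))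
                   (≤-trans (+-monoʳ-≤ (f i) (gain-mixed is))
                            (∑-jump l (mixed-∷ i is) (<ᵇ-true i l i<l) new))
      where
      new : f i + mixed is i ≤ mixed (i ∷ is) i
      new rewrite i∉is | ≡ᵇ-refl i = f+a≤b i

  -- The hybrid `mixed is`, which is `b` at the listed indices and `a` elsewhere, grows from `a`
  -- towards `b` one index at a time, so no index is credited twice.
  gain-≤ : ∀ is → gain l f is + ∑ l a ≤ ∑ l b
  gain-≤ is = ≤-trans (gain-mixed is) (∑-mono l (λ {i} _ → mixed≤b i))
    where
    mixed≤b : ∀ i → mixed is i ≤ b i
    mixed≤b i with elem i is
    ... | true  = ≤-refl
    ... | false = m+n≤o⇒n≤o (f i) (f+a≤b i)

-- The branch search and its soundness.

module Search (norm : ℕ → ℕ) (back : ℕ → ℕ → ℕ) (l : ℕ) where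

  dominators : Position → List Position
  dominators (s , i) = map (λ (t , d) → t , norm (d + i)) (reach s)

  -- Only candidates: clash tests them again, so truncated or wrapped values are harmless.
  reached : Position → Fin 2 → List ℕ
  reached (0F , i) 0F = i ∷ []
  reached (1F , i) 0F = i ∷ back 1 i ∷ back 3 i ∷ back 7 i ∷ []
  reached (0F , i) 1F = i ∷ back 4 i ∷ back 6 i ∷ back 7 i ∷ []
  reached (1F , i) 1F = back 7 i ∷ []

  -- The excess at a vertex grows only if the vertex was covered before, and then by one however
  -- often it was covered; hence `1 ⊓`.
  clash : List Position → Position → Fin 2 → ℕ → ℕ
  clash P v s i = if member v (dominators (s , i)) then 1 ⊓ count P (dominators (s , i)) else 0

  cost : List Position → Position → Fin 2 → ℕ
  cost P v s = gain l (clash P v s) (reached v s)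

  pay : ℕ → ℕ → (ℕ → Bool) → Bool
  pay c e k = if e <ᵇ c then true else k (e ∸ c)

  assume : Position → List Position → ℕ → ℕ → (ℕ → ℕ → Bool) → Bool
  assume v P e f k = pay (cost P v 0F) e (λ e′ → pay (cost P v 1F) f (λ f′ → k e′ f′))

  -- refute ws P N M e f ≡ true means that no admissible set contains P and avoids N with excess at most e in
  -- part 1 and f in part 2; it branches on how the targets ws are dominated. M is the undominated vertex of
  -- part 1, once it is known. The budgets are charged when a chosen vertex covers something covered before.
  mutual
    refute : List Position → List Position → List Position → Maybe ℕ → ℕ → ℕ → Bool
    refute []       P N M e f = false
    refute (w ∷ ws) P N M e f =
      if 0 <ᵇ count P (dominators w) then refute ws P N M e f
      else branch (dominators w) w ws P N M e f

    branch : List Position → Position → List Position →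
             List Position → List Position → Maybe ℕ → ℕ → ℕ → Bool
    branch []       w ws P N M e f = undominated w ws P N M e f
    branch (v ∷ vs) w ws P N M e f =
      if member v N then branch vs w ws P N M e f
      -- Passing `v` over puts it into the avoided list, so the branches are disjoint: each
      -- dominator is tried with all earlier ones excluded.
      else (assume v P e f (λ e′ f′ → refute ws (v ∷ P) N M e′ f′) ∧ branch vs w ws P (v ∷ N) M e f)

    undominated : Position → List Position →
                  List Position → List Position → Maybe ℕ → ℕ → ℕ → Bool
    undominated (1F , i) ws P N M        e f = true
    -- Holes are known to coincide only within the first `l` positions; a hole outside them makes
    -- the search give up.
    undominated (0F , i) ws P N nothing  e f = (i <ᵇ l) ∧ refute ws P N (just i) e f
    undominated (0F , i) ws P N (just j) e f =
      (i <ᵇ l) ∧ (if i ≡ᵇ j then refute ws P N (just j) e f else true)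

  start : List Position → List Position → (List Position → ℕ → ℕ → Bool) → ℕ → ℕ → Bool
  start []       P k e f = k P e f
  start (v ∷ vs) P k e f =
    not (member v P) ∧ assume v P e f (λ e′ f′ → start vs (v ∷ P) k e′ f′)

  module Soundness
    (χ : Fin 2 → ℕ → ℕ) (χ-norm : ∀ s i → χ s (norm i) ≡ χ s i)
    (second : ∀ i → coverage χ 1F i ≢ 0)
    (first  : ∀ {i j} → i < l → j < l → coverage χ 0F i ≡ 0 → coverage χ 0F j ≡ 0 → i ≡ j)
    where

    amount : Position → ℕ
    amount (s , i) = χ s i

    excess : Fin 2 → ℕ
    excess s = ∑ l (λ i → coverage χ s i ∸ 1)

    known : List Position → Fin 2 → ℕ
    known P s = ∑ l (λ i → count P (dominators (s , i)) ∸ 1)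

    Known : Maybe ℕ → Set
    Known nothing  = ⊤
    Known (just k) = ∀ i → i < l → coverage χ 0F i ≡ 0 → i ≡ k

    Chosen : List Position → Set
    Chosen = All (λ v → 0 < amount v)

    Avoided : List Position → Set
    Avoided = All (λ v → amount v ≡ 0)

    coverage≡ : ∀ s i → sum (map amount (dominators (s , i))) ≡ coverage χ s i
    coverage≡ s i = go (reach s)
      where
      go : ∀ ds → sum (map amount (map (λ (t , d) → t , norm (d + i)) ds)) ≡ sum (map (λ (t , d) → χ t (d + i)) ds)
      go []             = refl
      go ((t , d) ∷ ds) = cong₂ _+_ (χ-norm t (d + i)) (go ds)

    chosen-member : ∀ {P} → Chosen P → ∀ v → indicator (member v P) ≤ amount v
    chosen-member []                   v = z≤n
    chosen-member {w ∷ P} (0<w ∷ chosen) v with v == w in eq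
    ... | true rewrite ==-true v w eq = 0<w
    ... | false = chosen-member chosen v

    avoided-member : ∀ {N} → Avoided N → ∀ v → member v N ≡ true → amount v ≡ 0
    avoided-member {w ∷ N} (w≡0 ∷ avoided) v v∈N with v == w in eq
    ... | true rewrite ==-true v w eq = w≡0
    ... | false = avoided-member avoided v v∈N

    count≤ : ∀ {P} → Chosen P → ∀ vs → count P vs ≤ sum (map amount vs)
    count≤ chosen []       = z≤n
    count≤ chosen (v ∷ vs) = +-mono-≤ (chosen-member chosen v) (count≤ chosen vs)

    known≤excess : ∀ {P} → Chosen P → ∀ s → known P s ≤ excess s
    known≤excess chosen s = ∑-mono l λ {i} _ →
      ∸-monoˡ-≤ 1 (≤-trans (count≤ chosen (dominators (s , i))) (≤-reflexive (coverage≡ s i)))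

    known-∷ : ∀ P v → member v P ≡ false → ∀ s → cost P v s + known P s ≤ known (v ∷ P) s
    known-∷ P v v∉P s = gain-≤ l (λ i → pointwise (dominators (s , i))) (reached v s)
      where
      pointwise : ∀ cs → (if member v cs then 1 ⊓ count P cs else 0) + (count P cs ∸ 1) ≤ count (v ∷ P) cs ∸ 1
      pointwise cs with member v cs | count P cs | count-∷ v P cs v∉P | count-mono v P cs
      ... | false | c     | _ | le = ∸-monoˡ-≤ 1 le
      ... | true  | zero  | _ | _  = z≤n
      ... | true  | suc c | p | _  = ∸-monoˡ-≤ 1 p

    -- Here `b` is the true excess, and `x`, `y` are the excess known before and after a choice. A
    -- charge above the budget gives b ≤ e + x < c + x ≤ y ≤ b; otherwise it moves from the budget
    -- to the known excess.
    pay-sound : ∀ c e k {x y b} → pay c e k ≡ true → b ≤ e + x → c + x ≤ y → y ≤ b →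
                ∃[ e′ ] (k e′ ≡ true × b ≤ e′ + y)
    pay-sound c e k {x} {y} {b} paid b≤ c+x≤y y≤b with if-true paid
    ... | inj₁ (e<c , _) = contradiction
            (≤-trans (+-monoˡ-≤ x (<ᵇ-true e c e<c)) (≤-trans c+x≤y (≤-trans y≤b b≤))) (<-irrefl refl)
    ... | inj₂ (e≮c , ok) = e ∸ c , ok , (begin
      b               ≤⟨ b≤ ⟩
      e + x           ≡⟨ cong (_+ x) (sym (m∸n+n≡m (<ᵇ-false e c e≮c))) ⟩
      e ∸ c + c + x   ≡⟨ +-assoc (e ∸ c) c x ⟩
      e ∸ c + (c + x) ≤⟨ +-monoʳ-≤ (e ∸ c) c+x≤y ⟩
      e ∸ c + y       ∎)
      where open ≤-Reasoning

    -- The invariant of the search: unspent budget plus the excess already forced by `P` bounds the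
    -- true excess.
    Bounded : List Position → ℕ → ℕ → Set
    Bounded P e f = excess 0F ≤ e + known P 0F × excess 1F ≤ f + known P 1F

    assume-sound : ∀ k {v P e f} → assume v P e f k ≡ true → member v P ≡ false →
                   Chosen (v ∷ P) → Bounded P e f →
                   ∃₂ λ e′ f′ → k e′ f′ ≡ true × Bounded (v ∷ P) e′ f′
    assume-sound k {v} {P} {e} {f} ok v∉P chosen (b₀ , b₁) =
      let e′ , ok′ , b₀′ = pay-sound (cost P v 0F) e (λ e′ → pay (cost P v 1F) f (k e′)) ok b₀ (known-∷ P v v∉P 0F) (known≤excess chosen 0F)
          f′ , ok″ , b₁′ = pay-sound (cost P v 1F) f (k e′) ok′ b₁ (known-∷ P v v∉P 1F) (known≤excess chosen 1F)
      in e′ , f′ , ok″ , b₀′ , b₁′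

    mutual
      refute-sound : ∀ ws {P N M e f} → refute ws P N M e f ≡ true →
                     Chosen P → Avoided N → Known M → Bounded P e f → ⊥
      refute-sound (w ∷ ws) {P} ok chosen avoided known bounded with if-true ok
      ... | inj₁ (_ , ok′)   = refute-sound ws ok′ chosen avoided known bounded
      ... | inj₂ (cnt , ok′) = branch-sound (dominators w) w ws ok′
              (count≡0⇒∉ P (dominators w) (<ᵇ0-false _ cnt)) id chosen avoided known bounded

      -- The implication between the two sums records that the dominators of `w` already passed over
      -- are unchosen, so that reaching the empty list leaves `w` undominated.
      branch-sound : ∀ vs w ws {P N M e f} → branch vs w ws P N M e f ≡ true →
                     All (λ v → member v P ≡ false) vs →
                     (sum (map amount vs) ≡ 0 → sum (map amount (dominators w)) ≡ 0) →
                     Chosen P → Avoided N → Known M → Bounded P e f → ⊥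
      branch-sound [] w ws ok [] empty chosen avoided known bounded =
        undominated-sound w ws ok (trans (sym (coverage≡ (proj₁ w) (proj₂ w))) (empty refl)) chosen avoided known bounded
      branch-sound (v ∷ vs) w ws {P} ok (v∉P ∷ vs∉P) empty chosen avoided known bounded with if-true ok
      ... | inj₁ (v∈N , ok′) = branch-sound vs w ws ok′ vs∉P
              (λ eq → empty (trans (cong (_+ sum (map amount vs)) (avoided-member avoided v v∈N)) eq))
              chosen avoided known bounded
      ... | inj₂ (_ , ok′) with ∧-true ok′
      ...   | yes-v , no-v with 0 <? amount v
      ...     | no v≯0 =
                let v≡0 = n≤0⇒n≡0 (≮⇒≥ v≯0)
                in branch-sound vs w ws no-v vs∉P (λ eq → empty (cong₂ _+_ v≡0 eq))
                     chosen (v≡0 ∷ avoided) known bounded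
      ...     | yes 0<v =
                let e′ , f′ , ok″ , bounded′ = assume-sound (refute ws (v ∷ _) _ _) yes-v v∉P (0<v ∷ chosen) bounded
                in refute-sound ws ok″ (0<v ∷ chosen) avoided known bounded′

      undominated-sound : ∀ w ws {P N M e f} → undominated w ws P N M e f ≡ true →
                          coverage χ (proj₁ w) (proj₂ w) ≡ 0 →
                          Chosen P → Avoided N → Known M → Bounded P e f → ⊥
      undominated-sound (1F , i) ws ok w≡0 _ _ _ _ = second i w≡0
      undominated-sound (0F , i) ws {M = nothing} ok w≡0 chosen avoided _ bounded with ∧-true ok
      ... | i<l , ok′ =
              refute-sound ws ok′ chosen avoided (λ _ j<l j≡0 → first j<l (<ᵇ-true i l i<l) j≡0 w≡0) bounded
      undominated-sound (0F , i) ws {M = just j} ok w≡0 chosen avoided known bounded with ∧-true ok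
      ... | i<l , ok′ with if-true ok′
      ...   | inj₁ (_ , ok″) = refute-sound ws ok″ chosen avoided known bounded
      ...   | inj₂ (i≢j , _) with trans (sym i≢j) (trans (cong (i ≡ᵇ_) (sym (known i (<ᵇ-true i l i<l) w≡0))) (≡ᵇ-refl i))
      ...     | ()

    start-sound : ∀ vs {P k e f} → start vs P k e f ≡ true → Chosen vs → Chosen P → Bounded P e f →
                  ∃ λ P′ → ∃₂ λ e′ f′ → k P′ e′ f′ ≡ true × Chosen P′ × Bounded P′ e′ f′
    start-sound []       {P} ok _ chosen bounded = P , _ , _ , ok , chosen , bounded
    start-sound (v ∷ vs) {k = k} ok (0<v ∷ vs>0) chosen bounded with ∧-true ok
    ... | v∉P , ok′ =
      let _ , _ , ok″ , bounded′ = assume-sound (start vs (v ∷ _) k) ok′ (not-true v∉P) (0<v ∷ chosen) bounded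
      in start-sound vs ok″ vs>0 (0<v ∷ chosen) bounded′

    contradictory : ∀ ws vs {N M e f} → start vs [] (λ P → refute ws P N M) e f ≡ true →
                    Chosen vs → Avoided N → Known M → excess 0F ≤ e → excess 1F ≤ f → ⊥
    contradictory ws vs ok chosen avoided known e₀ e₁ =
      let _ , _ , _ , ok′ , chosen′ , bounded =
            start-sound vs ok chosen [] (≤-trans e₀ (m≤m+n _ _) , ≤-trans e₁ (m≤m+n _ _))
      in refute-sound ws ok′ chosen′ avoided known bounded

-- Search windows and starting irregularities.

-- Targets by distance from the irregularity, which is placed at position 18 to leave room on its left.
-- The two centres were found by experiment and affect only the size of the search.
outward : List Position
outward = concatMap (λ k → (0F , 19 + k) ∷ (1F , 15 + k) ∷ (0F , 19 ∸ k) ∷ (1F , 15 ∸ k) ∷ []) (upTo 14)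

pairOf : Fin 2 → ℕ → List Position
pairOf s g = (s , 18) ∷ (s , 18 + g) ∷ []

blank : Fin 2 → List Position
blank s = map (λ i → s , 18 + i) (upTo 5)

record Mode : Set where
  constructor mode
  field
    norm : ℕ → ℕ
    back : ℕ → ℕ → ℕ
    size : ℕ

-- A window of 34 positions never closes up on a cycle with m ≥ 34.
linear : Mode
linear = mode id (λ d i → i ∸ d) 34

cyclic : ∀ m → .{{NonZero m}} → Mode
cyclic m = mode (_% m) (λ d i → (i + (m ∸ d)) % m) m

module _ (μ : Mode) where
  open Mode μ
  open Search norm back size

  normal : List Position → List Position
  normal = map λ (s , i) → s , norm i

  search : List Position → List Position → List Position → Maybe ℕ → ℕ → ℕ → Bool
  search ws vs us M e f = start (normal vs) [] (λ P → refute (normal ws) P (normal us) M) e f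

  -- Opaque so that the search is not unfolded when types mentioning it are compared.
  opaque
    refutes : List Position → List Position → Maybe ℕ → ℕ → ℕ → Bool
    refutes = search outward

    refutes⇒search : ∀ vs us M e f → refutes vs us M e f ≡ true → search outward vs us M e f ≡ true
    refutes⇒search vs us M e f ok = ok

  PairsRefuted : Fin 2 → Maybe ℕ → ℕ → ℕ → Set
  PairsRefuted s M e f = All (λ g → refutes (pairOf s g) [] M e f ≡ true) (1 ∷ 2 ∷ 3 ∷ 4 ∷ [])

  BlankRefuted : Fin 2 → Maybe ℕ → ℕ → ℕ → Set
  BlankRefuted s M e f = refutes [] (blank s) M e f ≡ true

-- Configurations, their excess, and the exclusion of irregularities.

-- At most κ vertices of part 1 are undominated: 1 ∸ c is 1 exactly when c is 0.
record Configuration (m a b κ : ℕ) : Set where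
  field
    χ        : Fin 2 → ℕ → ℕ
    periodic : ∀ s i → χ s (i + m) ≡ χ s i
    bit      : ∀ s i → χ s i ≤ 1
    total₀   : ∑ m (χ 0F) ≡ a
    total₁   : ∑ m (χ 1F) ≡ b
    holes    : ∑ m (λ i → 1 ∸ coverage χ 0F i) ≤ κ
    second   : ∀ i → coverage χ 1F i ≢ 0

record Fits (m : ℕ) (μ : Mode) : Set where
  open Mode μ
  field
    size≤     : size ≤ m
    norm-sound : ∀ {f : ℕ → ℕ} → (∀ i → f (i + m) ≡ f i) → ∀ i → f (norm i) ≡ f i

linear-fits : ∀ {m} → 34 ≤ m → Fits m linear
linear-fits 34≤m = record { size≤ = 34≤m ; norm-sound = λ _ _ → refl }

cyclic-fits : ∀ {m} .{{_ : NonZero m}} → Fits m (cyclic m)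
cyclic-fits = record { size≤ = ≤-refl ; norm-sound = periodic-% }

-- With no hole allowed, the out-of-range value size μ says that every vertex in range is dominated.
memory : Mode → ℕ → Maybe ℕ
memory μ zero    = just (Mode.size μ)
memory μ (suc _) = nothing

module _ {m a b κ : ℕ} (κ≤1 : κ ≤ 1) (C : Configuration m a b κ) where
  open Configuration C

  shift-periodic : ∀ s d i → χ s (d + (i + m)) ≡ χ s (d + i)
  shift-periodic s d i = trans (cong (χ s) (sym (+-assoc d i m))) (periodic s (d + i))

  coverage-periodic : ∀ s i → coverage χ s (i + m) ≡ coverage χ s i
  coverage-periodic s i = go (reach s)
    where
    go : ∀ ds → sum (map (λ (t , d) → χ t (d + (i + m))) ds) ≡ sum (map (λ (t , d) → χ t (d + i)) ds)
    go []             = refl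
    go ((t , d) ∷ ds) = cong₂ _+_ (shift-periodic t d i) (go ds)

  ∑χ : ∀ s d → ∑ m (λ i → χ s (d + i)) ≡ ∑ m (χ s)
  ∑χ s d = ∑-shift m (χ s) (periodic s) d

  -- Written out for five summands because `coverage` unfolds to this form; every shift of `χ` has
  -- the same sum over a period.
  total-5 : ∀ s₁ s₂ s₃ s₄ s₅ d₁ d₂ d₃ d₄ d₅ →
    ∑ m (λ i → χ s₁ (d₁ + i) + (χ s₂ (d₂ + i) + (χ s₃ (d₃ + i) + (χ s₄ (d₄ + i) + (χ s₅ (d₅ + i) + 0))))) ≡
    ∑ m (χ s₁) + (∑ m (χ s₂) + (∑ m (χ s₃) + (∑ m (χ s₄) + (∑ m (χ s₅) + 0))))
  total-5 s₁ s₂ s₃ s₄ s₅ d₁ d₂ d₃ d₄ d₅ =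
    ∑+ s₁ d₁ (∑+ s₂ d₂ (∑+ s₃ d₃ (∑+ s₄ d₄ (∑+ s₅ d₅ (trans (∑-const m 0) (*-zeroʳ m))))))
    where
    ∑+ : ∀ s d {g c} → ∑ m g ≡ c → ∑ m (λ i → χ s (d + i) + g i) ≡ ∑ m (χ s) + c
    ∑+ s d {g} eq = trans (∑-+ m (λ i → χ s (d + i)) g) (cong₂ _+_ (∑χ s d) eq)

  total-first : ∑ m (coverage χ 0F) ≡ a + 4 * b
  total-first = trans (total-5 0F 1F 1F 1F 1F 0 0 1 3 7) (cong₂ (λ x y → x + 4 * y) total₀ total₁)

  total-second : ∑ m (coverage χ 1F) ≡ b + 4 * a
  total-second = trans (total-5 1F 0F 0F 0F 0F 7 7 6 4 0) (cong₂ (λ x y → y + 4 * x) total₀ total₁)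

  -- Pointwise 1 + (c ∸ 1) = (1 ∸ c) + c, and the holes contribute at most `κ` to the sum of the
  -- right-hand sides.
  excess-first : m + ∑ m (λ i → coverage χ 0F i ∸ 1) ≤ κ + (a + 4 * b)
  excess-first = begin
    m + ∑ m (λ i → coverage χ 0F i ∸ 1)
      ≡⟨ cong (_+ ∑ m (λ i → coverage χ 0F i ∸ 1)) (trans (sym (*-identityʳ m)) (sym (∑-const m 1))) ⟩
    ∑ m (λ _ → 1) + ∑ m (λ i → coverage χ 0F i ∸ 1)
      ≡⟨ sym (∑-+ m (λ _ → 1) (λ i → coverage χ 0F i ∸ 1)) ⟩
    ∑ m (λ i → 1 + (coverage χ 0F i ∸ 1))
      ≡⟨ ∑-cong m (λ i → balance (coverage χ 0F i)) ⟩
    ∑ m (λ i → (1 ∸ coverage χ 0F i) + coverage χ 0F i)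
      ≡⟨ ∑-+ m (λ i → 1 ∸ coverage χ 0F i) (coverage χ 0F) ⟩
    ∑ m (λ i → 1 ∸ coverage χ 0F i) + ∑ m (coverage χ 0F)
      ≤⟨ +-mono-≤ holes (≤-reflexive total-first) ⟩
    κ + (a + 4 * b) ∎
    where
    open ≤-Reasoning
    balance : ∀ c → 1 + (c ∸ 1) ≡ (1 ∸ c) + c
    balance zero    = refl
    balance (suc c) = cong (_+ suc c) (sym (0∸n≡0 c))

  excess-second : m + ∑ m (λ i → coverage χ 1F i ∸ 1) ≡ b + 4 * a
  excess-second = begin
    m + ∑ m (λ i → coverage χ 1F i ∸ 1)
      ≡⟨ cong (_+ ∑ m (λ i → coverage χ 1F i ∸ 1)) (trans (sym (*-identityʳ m)) (sym (∑-const m 1))) ⟩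
    ∑ m (λ _ → 1) + ∑ m (λ i → coverage χ 1F i ∸ 1)
      ≡⟨ sym (∑-+ m (λ _ → 1) (λ i → coverage χ 1F i ∸ 1)) ⟩
    ∑ m (λ i → 1 + (coverage χ 1F i ∸ 1))
      ≡⟨ ∑-cong m (λ i → m+[n∸m]≡n (n≢0⇒n>0 (second i))) ⟩
    ∑ m (coverage χ 1F)
      ≡⟨ total-second ⟩
    b + 4 * a ∎
    where open ≡-Reasoning

  module _ {μ : Mode} (fits : Fits m μ) {e f : ℕ}
           (e₀ : κ + (a + 4 * b) ≤ m + e) (e₁ : b + 4 * a ≤ m + f) where
    open Mode μ
    open Fits fits
    open Search norm back size

    -- A search at fixed positions excludes the irregularity everywhere, since the translate by `p`
    -- keeps all that soundness assumes; `e₀` and `e₁` turn the totals into budgets.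
    refuted : ∀ p ws vs us → search μ ws vs us (memory μ κ) e f ≡ true →
              All (λ (s , i) → 0 < χ s (p + i)) vs → All (λ (s , i) → χ s (p + i) ≡ 0) us → ⊥
    refuted p ws vs us ok chosen avoided =
      contradictory (normal μ ws) (normal μ vs) ok
        (chosen-norm vs chosen) (avoided-norm us avoided) (memory-known κ holes) budget₀ budget₁
      where
      χₚ : Fin 2 → ℕ → ℕ
      χₚ s i = χ s (p + i)

      χₚ-norm : ∀ s i → χₚ s (norm i) ≡ χₚ s i
      χₚ-norm s = norm-sound (shift-periodic s p)

      chosen-norm : ∀ vs → All (λ (s , i) → 0 < χₚ s i) vs → All (λ (s , i) → 0 < χₚ s i) (normal μ vs)
      chosen-norm []             []       = []
      chosen-norm ((s , i) ∷ vs) (q ∷ qs) = subst (0 <_) (sym (χₚ-norm s i)) q ∷ chosen-norm vs qs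

      avoided-norm : ∀ us → All (λ (s , i) → χₚ s i ≡ 0) us → All (λ (s , i) → χₚ s i ≡ 0) (normal μ us)
      avoided-norm []             []       = []
      avoided-norm ((s , i) ∷ us) (q ∷ qs) = trans (χₚ-norm s i) q ∷ avoided-norm us qs

      coverage-shift : ∀ s i → coverage χₚ s i ≡ coverage χ s (p + i)
      coverage-shift s i = go (reach s)
        where
        go : ∀ ds → sum (map (λ (t , d) → χ t (p + (d + i))) ds) ≡ sum (map (λ (t , d) → χ t (d + (p + i))) ds)
        go []             = refl
        go ((t , d) ∷ ds) = cong₂ _+_ (cong (χ t) (x∙yz≈y∙xz p d i)) (go ds)

      hole : ℕ → ℕ
      hole i = 1 ∸ coverage χₚ 0F i

      ∑hole : ∑ m hole ≡ ∑ m (λ i → 1 ∸ coverage χ 0F i)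
      ∑hole = trans (∑-cong m (λ i → cong (1 ∸_) (coverage-shift 0F i)))
                    (∑-shift m (λ i → 1 ∸ coverage χ 0F i) (λ i → cong (1 ∸_) (coverage-periodic 0F i)) p)

      is-hole : ∀ {i} → coverage χₚ 0F i ≡ 0 → 0 < hole i
      is-hole eq rewrite eq = z<s

      first : ∀ {i j} → i < size → j < size → coverage χₚ 0F i ≡ 0 → coverage χₚ 0F j ≡ 0 → i ≡ j
      first {i} {j} i<l j<l i≡0 j≡0 with <-cmp i j
      ... | tri≈ _ i≡j _ = i≡j
      ... | tri< i<j _ _ = contradiction
              (≤-trans (∑-≥2 m hole i<j (≤-trans j<l size≤) (is-hole i≡0) (is-hole j≡0))
                       (≤-trans (≤-reflexive ∑hole) (≤-trans holes κ≤1))) λ { (s≤s ()) }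
      ... | tri> _ _ j<i = contradiction
              (≤-trans (∑-≥2 m hole j<i (≤-trans i<l size≤) (is-hole j≡0) (is-hole i≡0))
                       (≤-trans (≤-reflexive ∑hole) (≤-trans holes κ≤1))) λ { (s≤s ()) }

      second′ : ∀ i → coverage χₚ 1F i ≢ 0
      second′ i eq = second (p + i) (trans (sym (coverage-shift 1F i)) eq)

      open Soundness χₚ χₚ-norm second′ first

      memory-known : ∀ κ → ∑ m (λ i → 1 ∸ coverage χ 0F i) ≤ κ → Known (memory μ κ)
      memory-known zero    none i i<l i≡0 = contradiction
        (≤-trans (∑-≥1 m hole (≤-trans i<l size≤) (is-hole i≡0)) (≤-trans (≤-reflexive ∑hole) none)) λ ()
      memory-known (suc _) _ = tt

      excess-shift : ∀ s → excess s ≤ ∑ m (λ i → coverage χ s i ∸ 1)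
      excess-shift s = ≤-trans (∑-prefix (λ i → coverage χₚ s i ∸ 1) size≤)
        (≤-reflexive (trans (∑-cong m (λ i → cong (_∸ 1) (coverage-shift s i)))
          (∑-shift m (λ i → coverage χ s i ∸ 1) (λ i → cong (_∸ 1) (coverage-periodic s i)) p)))

      budget₀ : excess 0F ≤ e
      budget₀ = ≤-trans (excess-shift 0F) (+-cancelˡ-≤ m _ _ (≤-trans excess-first e₀))

      budget₁ : excess 1F ≤ f
      budget₁ = ≤-trans (excess-shift 1F) (+-cancelˡ-≤ m _ _ (≤-trans (≤-reflexive excess-second) e₁))

    window : Fin 2 → ℕ → ℕ
    window s p = ∑ 5 (λ k → χ s (18 + k + p))

    ∑window : ∀ s → ∑ m (window s) ≡ 5 * ∑ m (χ s)
    ∑window s = begin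
      ∑ m (window s)                                  ≡⟨ ∑-swap m 5 (λ p k → χ s (18 + k + p)) ⟩
      ∑ 5 (λ k → ∑ m (λ p → χ s (18 + k + p)))        ≡⟨ ∑-cong 5 (λ k → ∑χ s (18 + k)) ⟩
      ∑ 5 (λ _ → ∑ m (χ s))                           ≡⟨ ∑-const 5 (∑ m (χ s)) ⟩
      5 * ∑ m (χ s)                                   ∎
      where open ≡-Reasoning

    no-blank : ∀ s → BlankRefuted μ s (memory μ κ) e f → 5 * ∑ m (χ s) < m → ⊥
    no-blank s ok few =
      let p , none = ∃-below-average m (window s) 1
                       (≤-<-trans (≤-reflexive (∑window s)) (<-≤-trans few (≤-reflexive (sym (*-identityʳ m)))))
          zero-at : ∀ {k} → k < 5 → χ s (p + (18 + k)) ≡ 0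
          zero-at {k} k<5 = trans (cong (χ s) (+-comm p (18 + k))) (∑≡0 5 (λ k → χ s (18 + k + p)) none k<5)
      in refuted p outward [] (blank s) (refutes⇒search μ [] (blank s) (memory μ κ) e f ok) []
           (zero-at (m≤m+n 1 _) ∷ zero-at (m≤m+n 2 _) ∷ zero-at (m≤m+n 3 _) ∷ zero-at (m≤m+n 4 _) ∷ zero-at (m≤m+n 5 _) ∷ [])

    no-pairs : ∀ s → PairsRefuted μ s (memory μ κ) e f → m < 5 * ∑ m (χ s) → ⊥
    no-pairs s ok many =
      let p , two = ∃-above-average m (window s) 1
                      (≤-<-trans (≤-reflexive (*-identityʳ m)) (<-≤-trans many (≤-reflexive (sym (∑window s)))))
          i , j , i<j , j<5 , 0<i , 0<j = ∑>1 5 (λ k → χ s (18 + k + p)) (λ k → bit s (18 + k + p)) two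
          g , j≡ = m≤n⇒∃[o]m+o≡n i<j
      -- Translating by `i + p` brings the first chosen vertex to position 18, as `pairOf` expects;
      -- the distance `suc g` is below five because both lie in one window.
      in refuted (i + p) outward (pairOf s (suc g)) [] (refutes⇒search μ (pairOf s (suc g)) [] (memory μ κ) e f (gap-ok g (≤-trans (m≤n+m (suc (suc g)) i) (≤-trans (≤-reflexive (trans (+-suc i (suc g)) (cong suc (trans (+-suc i g) j≡)))) j<5)) ok))
           (subst (λ x → 0 < χ s x) (trans (+-assoc 18 i p) (+-comm 18 (i + p))) 0<i
           ∷ subst (λ x → 0 < χ s x) (position i g j p j≡) 0<j ∷ []) []
      where
      position : ∀ i g j p → suc i + g ≡ j → 18 + j + p ≡ i + p + (18 + suc g)
      position i g .(suc i + g) p refl = lemma i g p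
        where
        lemma : ∀ i g p → 18 + (suc i + g) + p ≡ i + p + (18 + suc g)
        lemma = solve-∀

      gap-ok : ∀ g → suc g < 5 → PairsRefuted μ s (memory μ κ) e f →
               refutes μ (pairOf s (suc g)) [] (memory μ κ) e f ≡ true
      gap-ok 0 _ (ok ∷ _)             = ok
      gap-ok 1 _ (_ ∷ ok ∷ _)         = ok
      gap-ok 2 _ (_ ∷ _ ∷ ok ∷ _)     = ok
      gap-ok 3 _ (_ ∷ _ ∷ _ ∷ ok ∷ _) = ok
      gap-ok (suc (suc (suc (suc g)))) (s≤s (s≤s (s≤s (s≤s (s≤s ()))))) ok

-- Evaluated searches and the resulting lower bounds.

-- Hides the mode, so that the cyclic searches for small m and the linear one for large m have one
-- type.
record Evidence (m : ℕ) (P : Mode → Set) : Set where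
  constructor evidence
  field
    {refuter} : Mode
    fits      : Fits m refuter
    holds     : P refuter

open Evidence using (fits; holds)


fits₃₄ : ∀ n → Fits (34 + n) linear
fits₃₄ n = linear-fits (m≤m+n 34 n)

opaque
  unfolding refutes

  -- Each `refl` runs a search. The budgets are what a + 4b and b + 4a exceed r by, for a surplus (a
  -- , b) beyond t in each part: (0 , 1) gives 3 and 0, and (1 , 0) gives 0 and 3. With a hole
  -- allowed, the first budget is one larger.
  evidence-full-1 : ∀ k → Evidence (1 + (2 + k) * 5) λ μ →
    BlankRefuted μ 0F (memory μ 0) 3 0 × BlankRefuted μ 1F (memory μ 0) 0 3
  evidence-full-1 0 = evidence (cyclic-fits {11}) (refl , refl)
  evidence-full-1 1 = evidence (cyclic-fits {16}) (refl , refl)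
  evidence-full-1 2 = evidence (cyclic-fits {21}) (refl , refl)
  evidence-full-1 3 = evidence (cyclic-fits {26}) (refl , refl)
  evidence-full-1 4 = evidence (cyclic-fits {31}) (refl , refl)
  -- Now m is symbolic and at least 36; the linear search never consults it, so one evaluation
  -- serves every `k`.
  evidence-full-1 (suc (suc (suc (suc (suc k))))) = evidence (fits₃₄ (2 + k * 5)) (refl , refl)

  evidence-near-2 : ∀ k → Evidence (2 + (2 + k) * 5) λ μ → BlankRefuted μ 1F (memory μ 1) 0 2
  evidence-near-2 0 = evidence (cyclic-fits {12}) refl
  evidence-near-2 1 = evidence (cyclic-fits {17}) refl
  evidence-near-2 2 = evidence (cyclic-fits {22}) refl
  evidence-near-2 3 = evidence (cyclic-fits {27}) refl
  evidence-near-2 4 = evidence (cyclic-fits {32}) refl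
  evidence-near-2 (suc (suc (suc (suc (suc k))))) = evidence (fits₃₄ (3 + k * 5)) refl

  evidence-near-3 : ∀ k → Evidence (3 + (4 + k) * 5) λ μ →
    PairsRefuted μ 0F (memory μ 1) 3 2 × BlankRefuted μ 1F (memory μ 1) 0 5
  evidence-near-3 0 = evidence (cyclic-fits {23}) ((refl ∷ refl ∷ refl ∷ refl ∷ []) , refl)
  evidence-near-3 1 = evidence (cyclic-fits {28}) ((refl ∷ refl ∷ refl ∷ refl ∷ []) , refl)
  evidence-near-3 2 = evidence (cyclic-fits {33}) ((refl ∷ refl ∷ refl ∷ refl ∷ []) , refl)
  evidence-near-3 (suc (suc (suc k))) = evidence (fits₃₄ (4 + k * 5)) ((refl ∷ refl ∷ refl ∷ refl ∷ []) , refl)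

  evidence-full-4 : ∀ k → Evidence (4 + (3 + k) * 5) λ μ →
    PairsRefuted μ 0F (memory μ 0) 5 2 × PairsRefuted μ 1F (memory μ 0) 2 5
  evidence-full-4 0 = evidence (cyclic-fits {19}) ((refl ∷ refl ∷ refl ∷ refl ∷ []) , (refl ∷ refl ∷ refl ∷ refl ∷ []))
  evidence-full-4 1 = evidence (cyclic-fits {24}) ((refl ∷ refl ∷ refl ∷ refl ∷ []) , (refl ∷ refl ∷ refl ∷ refl ∷ []))
  evidence-full-4 2 = evidence (cyclic-fits {29}) ((refl ∷ refl ∷ refl ∷ refl ∷ []) , (refl ∷ refl ∷ refl ∷ refl ∷ []))
  evidence-full-4 (suc (suc (suc k))) = evidence (fits₃₄ (k * 5)) ((refl ∷ refl ∷ refl ∷ refl ∷ []) , (refl ∷ refl ∷ refl ∷ refl ∷ []))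

  evidence-full-13 : Evidence 13 λ μ → PairsRefuted μ 0F (memory μ 0) 2 2
  evidence-full-13 = evidence (cyclic-fits {13}) (refl ∷ refl ∷ refl ∷ refl ∷ [])

  evidence-near-14 : Evidence 14 λ μ → PairsRefuted μ 0F (memory μ 1) 2 1
  evidence-near-14 = evidence (cyclic-fits {14}) (refl ∷ refl ∷ refl ∷ refl ∷ [])

numeral : ∀ {i j} {i≤j : True (i ≤? j)} → i ≤ j
numeral {i≤j = p} = toWitness p

absurd : ∀ {i j} {i≰j : False (i ≤? j)} → i ≤ j → ⊥
absurd {i≰j = p} = toWitnessFalse p

-- Both parts have at least t vertices, which leaves finitely many cases for what they have beyond t.
reduce : ∀ r t c {a b κ} → κ ≤ 1 → c + κ ≤ r → Configuration (r + t * 5) a b κ → a + b ≤ c + t * 2 →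
         (∀ a b → a + b ≤ c → r ≤ b + 4 * a → r ≤ κ + (a + 4 * b) →
                  Configuration (r + t * 5) (a + t) (b + t) κ → ⊥) → ⊥
reduce r t c {a} {b} {κ} κ≤1 c+κ≤r C a+b≤ cases =
  go (m≤n⇒∃[o]o+m≡n t≤a) (m≤n⇒∃[o]o+m≡n t≤b) C a+b≤ first second
  where
  m≤n⇒∃[o]o+m≡n : ∀ {m n} → m ≤ n → ∃[ o ] o + m ≡ n
  m≤n⇒∃[o]o+m≡n m≤n = _ , m∸n+n≡m m≤n

  first : r + t * 5 ≤ κ + (a + 4 * b)
  first = ≤-trans (m≤m+n _ _) (excess-first κ≤1 C)

  second : r + t * 5 ≤ b + 4 * a
  second = ≤-trans (m≤m+n _ _) (≤-reflexive (excess-second κ≤1 C))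

  open ≤-Reasoning

  -- If a < t, then b + 4a = (a + b) + 3a would fall below c + 5t, hence below m. The bound for b is
  -- the same with `κ` included.
  t≤a : t ≤ a
  t≤a = *-cancelˡ-≤ 3 (+-cancelˡ-≤ (c + t * 2) _ _ (begin
    c + t * 2 + 3 * t   ≡⟨ lemma₁ c t ⟩
    c + t * 5           ≤⟨ +-monoˡ-≤ (t * 5) (m+n≤o⇒m≤o c c+κ≤r) ⟩
    r + t * 5           ≤⟨ second ⟩
    b + 4 * a           ≡⟨ lemma₂ a b ⟩
    a + b + 3 * a       ≤⟨ +-monoˡ-≤ (3 * a) a+b≤ ⟩
    c + t * 2 + 3 * a   ∎))
    where
    lemma₁ : ∀ c t → c + t * 2 + 3 * t ≡ c + t * 5
    lemma₁ = solve-∀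
    lemma₂ : ∀ a b → b + 4 * a ≡ a + b + 3 * a
    lemma₂ = solve-∀

  t≤b : t ≤ b
  t≤b = *-cancelˡ-≤ 3 (+-cancelˡ-≤ (c + κ + t * 2) _ _ (begin
    c + κ + t * 2 + 3 * t   ≡⟨ lemma₁ c κ t ⟩
    c + κ + t * 5           ≤⟨ +-monoˡ-≤ (t * 5) c+κ≤r ⟩
    r + t * 5               ≤⟨ first ⟩
    κ + (a + 4 * b)         ≡⟨ lemma₂ a b κ ⟩
    κ + (a + b) + 3 * b     ≤⟨ +-monoˡ-≤ (3 * b) (+-monoʳ-≤ κ a+b≤) ⟩
    κ + (c + t * 2) + 3 * b ≡⟨ lemma₃ c κ t b ⟩
    c + κ + t * 2 + 3 * b   ∎))
    where
    lemma₁ : ∀ c κ t → c + κ + t * 2 + 3 * t ≡ c + κ + t * 5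
    lemma₁ = solve-∀
    lemma₂ : ∀ a b κ → κ + (a + 4 * b) ≡ κ + (a + b) + 3 * b
    lemma₂ = solve-∀
    lemma₃ : ∀ c κ t b → κ + (c + t * 2) + 3 * b ≡ c + κ + t * 2 + 3 * b
    lemma₃ = solve-∀

  go : ∀ {a b} → ∃[ a′ ] a′ + t ≡ a → ∃[ b′ ] b′ + t ≡ b → Configuration (r + t * 5) a b κ →
       a + b ≤ c + t * 2 → r + t * 5 ≤ κ + (a + 4 * b) → r + t * 5 ≤ b + 4 * a → ⊥
  go (a , refl) (b , refl) C a+b≤ first second = cases a b
    (+-cancelʳ-≤ (t * 2) _ _ (≤-trans (≤-reflexive (lemma₁ a b t)) a+b≤))
    (+-cancelʳ-≤ (t * 5) _ _ (≤-trans second (≤-reflexive (lemma₂ a b t))))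
    (+-cancelʳ-≤ (t * 5) _ _ (≤-trans first (≤-reflexive (lemma₃ a b t κ)))) C
    where
    lemma₁ : ∀ a b t → a + b + t * 2 ≡ a + t + (b + t)
    lemma₁ = solve-∀
    lemma₂ : ∀ a b t → b + t + 4 * (a + t) ≡ b + 4 * a + t * 5
    lemma₂ = solve-∀
    lemma₃ : ∀ a b t κ → κ + (a + t + 4 * (b + t)) ≡ κ + (a + 4 * b) + t * 5
    lemma₃ = solve-∀

-- In terms of the surplus beyond t, the common 5t cancels from every inequality, so the remaining
-- hypotheses are about numerals although t is symbolic.
module Reduced (r t a b : ℕ) {κ : ℕ} (κ≤1 : κ ≤ 1) (C : Configuration (r + t * 5) (a + t) (b + t) κ)
               {μ : Mode} (fits : Fits (r + t * 5) μ) {e f : ℕ}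
               (e₀ : κ + (a + 4 * b) ≤ r + e) (e₁ : b + 4 * a ≤ r + f) where
  open Configuration C

  private
    swap-last : ∀ r t e → r + e + t * 5 ≡ r + t * 5 + e
    swap-last = solve-∀

    e₀′ : κ + (a + t + 4 * (b + t)) ≤ r + t * 5 + e
    e₀′ = ≤-trans (≤-reflexive (lemma a b t κ)) (≤-trans (+-monoˡ-≤ (t * 5) e₀) (≤-reflexive (swap-last r t e)))
      where
      lemma : ∀ a b t κ → κ + (a + t + 4 * (b + t)) ≡ κ + (a + 4 * b) + t * 5
      lemma = solve-∀

    e₁′ : b + t + 4 * (a + t) ≤ r + t * 5 + f
    e₁′ = ≤-trans (≤-reflexive (lemma a b t)) (≤-trans (+-monoˡ-≤ (t * 5) e₁) (≤-reflexive (swap-last r t f)))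
      where
      lemma : ∀ a b t → b + t + 4 * (a + t) ≡ b + 4 * a + t * 5
      lemma = solve-∀

    five : ∀ a t → 5 * (a + t) ≡ 5 * a + t * 5
    five = solve-∀

    many : ∀ {s x} → ∑ (r + t * 5) (χ s) ≡ x + t → r < 5 * x → r + t * 5 < 5 * ∑ (r + t * 5) (χ s)
    many {x = x} eq lt = <-≤-trans (+-monoˡ-< (t * 5) lt) (≤-reflexive (trans (sym (five x t)) (cong (5 *_) (sym eq))))

    few : ∀ {s x} → ∑ (r + t * 5) (χ s) ≡ x + t → 5 * x < r → 5 * ∑ (r + t * 5) (χ s) < r + t * 5
    few {x = x} eq lt = ≤-<-trans (≤-reflexive (trans (cong (5 *_) eq) (five x t))) (+-monoˡ-< (t * 5) lt)

  pairs₀ : PairsRefuted μ 0F (memory μ κ) e f → r < 5 * a → ⊥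
  pairs₀ ok lt = no-pairs κ≤1 C fits e₀′ e₁′ 0F ok (many total₀ lt)

  pairs₁ : PairsRefuted μ 1F (memory μ κ) e f → r < 5 * b → ⊥
  pairs₁ ok lt = no-pairs κ≤1 C fits e₀′ e₁′ 1F ok (many total₁ lt)

  blank₀ : BlankRefuted μ 0F (memory μ κ) e f → 5 * a < r → ⊥
  blank₀ ok lt = no-blank κ≤1 C fits e₀′ e₁′ 0F ok (few total₀ lt)

  blank₁ : BlankRefuted μ 1F (memory μ κ) e f → 5 * b < r → ⊥
  blank₁ ok lt = no-blank κ≤1 C fits e₀′ e₁′ 1F ok (few total₁ lt)


-- A single surplus vertex leaves the other part with exactly t vertices, and 5t < m yields a blank
-- window there.
bound-full-1 : ∀ k {a b} → Configuration (1 + (2 + k) * 5) a b 0 → 2 + (2 + k) * 2 ≤ a + b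
bound-full-1 k C = ≰⇒> λ a+b≤ → reduce 1 (2 + k) 1 z≤n numeral C a+b≤ λ where
    0 0 _ p _ _ → absurd p
    0 1 _ _ _ C → Reduced.blank₀ 1 (2 + k) 0 1 z≤n C (fits E) numeral numeral (proj₁ (holds E)) numeral
    1 0 _ _ _ C → Reduced.blank₁ 1 (2 + k) 1 0 z≤n C (fits E) numeral numeral (proj₂ (holds E)) numeral
    0 (suc (suc _)) (s≤s ()) _ _ _
    1 (suc _) (s≤s ()) _ _ _
    (suc (suc _)) _ (s≤s ()) _ _ _
  where
  E = evidence-full-1 k

bound-near-2 : ∀ k {a b} → Configuration (2 + (2 + k) * 5) a b 1 → 2 + (2 + k) * 2 ≤ a + b
bound-near-2 k C = ≰⇒> λ a+b≤ → reduce 2 (2 + k) 1 numeral numeral C a+b≤ λ where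
    0 0 _ p _ _ → absurd p
    0 1 _ p _ _ → absurd p
    1 0 _ _ _ C → Reduced.blank₁ 2 (2 + k) 1 0 numeral C (fits E) numeral numeral (holds E) numeral
    0 (suc (suc _)) (s≤s ()) _ _ _
    1 (suc _) (s≤s ()) _ _ _
    (suc (suc _)) _ (s≤s ()) _ _ _
  where
  E = evidence-near-2 k

bound-near-3 : ∀ k {a b} → Configuration (3 + (4 + k) * 5) a b 1 → 3 + (4 + k) * 2 ≤ a + b
bound-near-3 k C = ≰⇒> λ a+b≤ → reduce 3 (4 + k) 2 numeral numeral C a+b≤ λ where
    0 _ q p _ _ → absurd (≤-trans p (≤-trans (≤-reflexive (+-identityʳ _)) q))
    1 0 _ _ p _ → absurd p
    1 1 _ _ _ C → Reduced.pairs₀ 3 (4 + k) 1 1 numeral C (fits E) numeral numeral (proj₁ (holds E)) numeral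
    2 0 _ _ _ C → Reduced.blank₁ 3 (4 + k) 2 0 numeral C (fits E) numeral numeral (proj₂ (holds E)) numeral
    1 (suc (suc _)) (s≤s (s≤s ())) _ _ _
    2 (suc _) (s≤s (s≤s ())) _ _ _
    (suc (suc (suc _))) _ (s≤s (s≤s ())) _ _ _
  where
  E = evidence-near-3 k

bound-full-4 : ∀ k {a b} → Configuration (4 + (3 + k) * 5) a b 0 → 4 + (3 + k) * 2 ≤ a + b
bound-full-4 k C = ≰⇒> λ a+b≤ → reduce 4 (3 + k) 3 z≤n numeral C a+b≤ λ where
    0 _ q p _ _ → absurd (≤-trans p (≤-trans (≤-reflexive (+-identityʳ _)) q))
    1 0 _ _ p _ → absurd p
    -- The budgets computed for the surplus (1 , 2) are more than enough for (1 , 1).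
    1 1 _ _ _ C → Reduced.pairs₀ 4 (3 + k) 1 1 z≤n C (fits E) numeral numeral (proj₁ (holds E)) numeral
    1 2 _ _ _ C → Reduced.pairs₀ 4 (3 + k) 1 2 z≤n C (fits E) numeral numeral (proj₁ (holds E)) numeral
    2 0 _ _ p _ → absurd p
    2 1 _ _ _ C → Reduced.pairs₁ 4 (3 + k) 2 1 z≤n C (fits E) numeral numeral (proj₂ (holds E)) numeral
    3 0 _ _ p _ → absurd p
    1 (suc (suc (suc _))) (s≤s (s≤s (s≤s ()))) _ _ _
    2 (suc (suc _)) (s≤s (s≤s (s≤s ()))) _ _ _
    3 (suc _) (s≤s (s≤s (s≤s ()))) _ _ _
    (suc (suc (suc (suc _)))) _ (s≤s (s≤s (s≤s ()))) _ _ _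
  where
  E = evidence-full-4 k

-- Stated without a hole only: for m = 13, six vertices can dominate all vertices but one.
bound-full-13 : ∀ {a b} → Configuration 13 a b 0 → 7 ≤ a + b
bound-full-13 C = ≰⇒> λ a+b≤ → reduce 3 2 2 z≤n numeral C a+b≤ λ where
    0 _ q p _ _ → absurd (≤-trans p (≤-trans (≤-reflexive (+-identityʳ _)) q))
    1 0 _ _ p _ → absurd p
    1 1 _ _ _ C → Reduced.pairs₀ 3 2 1 1 z≤n C (fits E) numeral numeral (holds E) numeral
    2 0 _ _ p _ → absurd p
    1 (suc (suc _)) (s≤s (s≤s ())) _ _ _
    2 (suc _) (s≤s (s≤s ())) _ _ _
    (suc (suc (suc _))) _ (s≤s (s≤s ())) _ _ _
  where
  E = evidence-full-13

bound-near-14 : ∀ {a b} → Configuration 14 a b 1 → 7 ≤ a + b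
bound-near-14 C = ≰⇒> λ a+b≤ → reduce 4 2 2 numeral numeral C a+b≤ λ where
    0 _ q p _ _ → absurd (≤-trans p (≤-trans (≤-reflexive (+-identityʳ _)) q))
    1 0 _ _ p _ → absurd p
    1 1 _ _ _ C → Reduced.pairs₀ 4 2 1 1 numeral C (fits E) numeral numeral (holds E) numeral
    2 0 _ _ p _ → absurd p
    1 (suc (suc _)) (s≤s (s≤s ())) _ _ _
    2 (suc _) (s≤s (s≤s ())) _ _ _
    (suc (suc (suc _))) _ (s≤s (s≤s ())) _ _ _
  where
  E = evidence-near-14

-- Counting suffices, without search. If part 1 has no surplus, part 2 is covered at most once
-- beyond 5t; if part 1 has the only surplus vertex, part 1 gains one, or two with the hole. Both
-- are below 3.
bound-near : ∀ r t {a b} → 3 ≤ r → Configuration (r + t * 5) a b 1 → 2 + t * 2 ≤ a + b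
bound-near r t 3≤r C = ≰⇒> λ a+b≤ → reduce r t 1 numeral (≤-trans numeral 3≤r) C a+b≤ λ where
    0 _ q p _ _ → absurd (≤-trans 3≤r (≤-trans p (≤-trans (≤-reflexive (+-identityʳ _)) q)))
    1 0 _ _ p _ → absurd (≤-trans 3≤r p)
    1 (suc _) (s≤s ()) _ _ _
    (suc (suc _)) _ (s≤s ()) _ _ _

-- Domination numbers and criticality in arbitrary graphs.

-- Domination by closed neighbourhoods is monotone in the list and indifferent to repetitions, so
-- duplicates are removed only when `IsDominating` is needed.
Covered : (G : Graph) → List (Vertex G) → Vertex G → Set
Covered G D v = v ∈ D ⊎ (∃[ w ] (w ∈ D × Adj G v w))

covered-∷ : ∀ {G D u v} → Covered G D v → Covered G (u ∷ D) v
covered-∷ (inj₁ v∈D)             = inj₁ (there v∈D)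
covered-∷ (inj₂ (w , w∈D , adj)) = inj₂ (w , there w∈D , adj)

module _ {G : Graph} (_≟_ : DecidableEquality (Vertex G)) where
  open DecMembership _≟_ using (_∈?_)

  dominating⇒covered : ∀ {D} → IsDominating G D → ∀ v → Covered G D v
  dominating⇒covered {D} (_ , dominates) v with v ∈? D
  ... | yes v∈D = inj₁ v∈D
  ... | no  v∉D = inj₂ (dominates v v∉D)

  covered⇒dominating : ∀ {D} → (∀ v → Covered G D v) → IsDominating G (deduplicate _≟_ D)
  covered⇒dominating {D} covers = deduplicate-! _≟_ D , λ v v∉ → dominator v∉ (covers v)
    where
    dominator : ∀ {v} → v ∉ deduplicate _≟_ D → Covered G D v → ∃[ w ] (w ∈ deduplicate _≟_ D × Adj G v w)
    dominator v∉ (inj₁ v∈D)             = contradiction (∈-deduplicate⁺ _≟_ v∈D) v∉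
    dominator v∉ (inj₂ (w , w∈D , adj)) = w , ∈-deduplicate⁺ _≟_ w∈D , adj

  dominationNumber≤ : ∀ {D k} → IsDominationNumber G k → (∀ v → Covered G D v) → k ≤ length D
  dominationNumber≤ {D} (_ , minimal) covers =
    ≤-trans (minimal _ (covered⇒dominating covers)) (length-deduplicate _≟_ D)

  -- Deduplication might shorten `D`, but minimality forbids it.
  isDominationNumber : ∀ {D k} → (∀ v → Covered G D v) → length D ≡ k →
                       (∀ E → (∀ v → Covered G E v) → k ≤ length E) → IsDominationNumber G k
  isDominationNumber {D} covers refl minimal =
    (deduplicate _≟_ D , dominating ,
     ≤-antisym (length-deduplicate _≟_ D) (minimal _ (dominating⇒covered dominating))) ,
    λ E E-dominating → minimal E (dominating⇒covered E-dominating)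
    where
    dominating : IsDominating G (deduplicate _≟_ D)
    dominating = covered⇒dominating covers

CoversExcept : (G : Graph) → Vertex G → List (Vertex G) → Set
CoversExcept G u D = ∀ v → v ≢ u → Covered G D v

module _ (G : Graph) {u : Vertex G} where

  values-coverExcept : ∀ {D} → (∀ v → Covered (delete G u) D v) → CoversExcept G u (map value D)
  values-coverExcept covers v v≢u with covers (v Refinement., [ v≢u ])
  ... | inj₁ v∈D             = inj₁ (∈-map⁺ value v∈D)
  ... | inj₂ (w , w∈D , adj) = inj₂ (value w , ∈-map⁺ value w∈D , adj)

  restrict : ∀ {D} → All (u ≢_) D → List (Vertex (delete G u))
  restrict []                = []
  restrict {v ∷ _} (u≢v ∷ avoids) = (v Refinement., [ u≢v ∘ sym ]) ∷ restrict avoids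

  length-restrict : ∀ {D} (avoids : All (u ≢_) D) → length (restrict avoids) ≡ length D
  length-restrict []           = refl
  length-restrict (_ ∷ avoids) = cong suc (length-restrict avoids)

  ∈-restrict : ∀ {D} (avoids : All (u ≢_) D) {v} → value v ∈ D → v ∈ restrict avoids
  ∈-restrict (_ ∷ _)      (here eq)   = here (Refinement.value-injective eq)
  ∈-restrict (_ ∷ avoids) (there v∈D) = there (∈-restrict avoids v∈D)

  restrict-covers : ∀ {D} (avoids : All (u ≢_) D) → CoversExcept G u D →
                    ∀ v → Covered (delete G u) (restrict avoids) v
  restrict-covers avoids covers (x Refinement., [ x≢u ]) with covers x (¬-recompute x≢u)
  ... | inj₁ x∈D             = inj₁ (∈-restrict avoids x∈D)
  ... | inj₂ (w , w∈D , adj) =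
    inj₂ ((w Refinement., [ (λ w≡u → All.lookup avoids w∈D (sym w≡u)) ]) , ∈-restrict avoids w∈D , adj)

module _ {G : Graph} (_≟_ : DecidableEquality (Vertex G)) where

  private
    _≟ᵈ_ : ∀ {u} → DecidableEquality (Vertex (delete G u))
    _≟ᵈ_ = Refinement._≟_ _≟_

    fill : ∀ {u D} → CoversExcept G u D → ∀ v → Covered G (u ∷ D) v
    fill {u} covers v with v ≟ u
    ... | yes refl = inj₁ (here refl)
    ... | no  v≢u  = covered-∷ {G} (covers v v≢u)

  -- A list of length `g` covering all but `u` cannot contain `u`, or it would cover everything; so
  -- it lives in the deleted graph. Conversely, adding `u` to a dominating list of the deleted graph
  -- covers `G`, so deletion saves at most one.
  γ-critical : ∀ g → (∀ D → (∀ v → Covered G D v) → suc g ≤ length D) →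
               (∀ u → ∃[ D ] (length D ≡ g × CoversExcept G u D)) → γ-Critical G
  γ-critical g lower near u with near u
  ... | D , refl , covers = g , suc g , deleted , isDominationNumber {G} _≟_ (fill covers) refl lower , ≤-refl
    where
    avoids : All (u ≢_) D
    avoids = ¬Any⇒All¬ D λ u∈D → 1+n≰n (lower D λ v → covers-all u∈D v)
      where
      covers-all : u ∈ D → ∀ v → Covered G D v
      covers-all u∈D v with v ≟ u
      ... | yes refl = inj₁ u∈D
      ... | no  v≢u  = covers v v≢u

    deleted : IsDominationNumber (delete G u) g
    deleted = isDominationNumber {delete G u} _≟ᵈ_ (restrict-covers G avoids covers) (length-restrict G avoids)
      λ E E-covers → s≤s⁻¹ (≤-trans (lower _ (fill (values-coverExcept G E-covers)))
                                    (≤-reflexive (cong suc (length-map value E))))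

  -- One vertex is enough: a dominating list of the deleted graph covers all of `G` but `u`, hence
  -- has length at least `g`, while `G` itself needs at most `g`.
  ¬γ-critical : ∀ u g → ∃[ D ] (length D ≡ g × (∀ v → Covered G D v)) →
                (∀ D → CoversExcept G u D → g ≤ length D) → ¬ γ-Critical G
  ¬γ-critical u g (D , refl , covers) lower critical with critical u
  ... | a , b , ((E , E-dominating , refl) , _) , γ[G]≡b , a<b =
    <⇒≱ (<-≤-trans a<b (dominationNumber≤ {G} _≟_ γ[G]≡b covers))
        (≤-trans (lower _ (values-coverExcept G (dominating⇒covered {delete G u} _≟ᵈ_ E-dominating)))
                 (≤-reflexive (length-map value E)))

-- From vertex lists of the Knödel graph to configurations.

+-cong-% : ∀ m .{{_ : NonZero m}} x {i j} → i % m ≡ j % m → (x + i) % m ≡ (x + j) % m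
+-cong-% m x {i} {j} eq =
  trans (%-distribˡ-+ x i m) (trans (cong (λ k → (x % m + k) % m) eq) (sym (%-distribˡ-+ x j m)))

+-cancel-% : ∀ m .{{_ : NonZero m}} x {i j} → (x + i) % m ≡ (x + j) % m → i % m ≡ j % m
+-cancel-% m x {i} {j} eq = trans (sym (strip i)) (trans (+-cong-% m y eq) (strip j))
  where
  y : ℕ
  -- A natural number representing the negative of `x` modulo `m`.
  y = x * m ∸ x

  y+x : y + x ≡ x * m
  y+x = m∸n+n≡m (m≤m*n x m)

  strip : ∀ k → (y + (x + k)) % m ≡ k % m
  strip k = trans (cong (_% m) (trans (sym (+-assoc y x k)) (cong (_+ k) y+x)))
                 (%-remove-+ˡ k (divides x refl))

sum-map>0 : ∀ {A : Set} {f : A → ℕ} {x xs} → x ∈ xs → 0 < f x → 0 < sum (map f xs)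
sum-map>0 (here refl) 0<fx = ≤-trans 0<fx (m≤m+n _ _)
sum-map>0 {f = f} {xs = y ∷ _} (there x∈xs) 0<fx = ≤-trans (sum-map>0 x∈xs 0<fx) (m≤n+m _ (f y))

module Knödel (n : ℕ) .{{_ : NonZero (n / 2)}} where

  m : ℕ
  m = n / 2

  V : Set
  V = KnödelVertex n

  G : Graph
  G = W 4 n

  _≟ᵛ_ : DecidableEquality V
  _≟ᵛ_ = ≡-dec Fin._≟_ Fin._≟_

  open DecMembership _≟ᵛ_ using (_∈?_)

  jump : Fin 4 → ℕ
  jump k = 2 ^ toℕ k ∸ 1

  vertex : Fin 2 → ℕ → V
  vertex s i = s , i mod m

  toℕ-mod : ∀ i → toℕ (i mod m) ≡ i % m
  toℕ-mod i = toℕ-fromℕ< (m%n<n i m)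

  vertex-cong : ∀ s {i j} → i % m ≡ j % m → vertex s i ≡ vertex s j
  vertex-cong s {i} {j} eq = cong (s ,_) (toℕ-injective (trans (toℕ-mod i) (trans eq (sym (toℕ-mod j)))))

  vertex-injective : ∀ {s t i j} → i < m → j < m → vertex s i ≡ vertex t j → i ≡ j
  vertex-injective {i = i} {j} i<m j<m eq = trans (sym (m<n⇒m%n≡m i<m)) (trans
    (trans (sym (toℕ-mod i)) (trans (cong (toℕ ∘ proj₂) eq) (toℕ-mod j))) (m<n⇒m%n≡m j<m))

  toℕ-% : ∀ (j : Fin m) → toℕ j % m ≡ toℕ j
  toℕ-% j = m<n⇒m%n≡m (toℕ<n j)

  vertex-toℕ : ∀ s j → vertex s (toℕ j) ≡ (s , j)
  vertex-toℕ s j = cong (s ,_) (toℕ-injective (trans (toℕ-mod (toℕ j)) (toℕ-% j)))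

  vertex-≡ : ∀ s i j → i % m ≡ toℕ j → (s , j) ≡ vertex s i
  vertex-≡ s i j eq = cong (s ,_) (toℕ-injective (trans (sym eq) (sym (toℕ-mod i))))

  edge : ∀ k {i j} → j % m ≡ (jump k + i) % m → KnödelAdj 4 n (vertex 0F i) (vertex 1F j)
  edge k {i} {j} eq = k , position
    where
    open ≡-Reasoning
    position : toℕ (j mod m) ≡ (toℕ (i mod m) + jump k) % m
    position = begin
      toℕ (j mod m)                 ≡⟨ toℕ-mod j ⟩
      j % m                         ≡⟨ eq ⟩
      (jump k + i) % m              ≡⟨ +-cong-% m (jump k) (sym (m%n%n≡m%n i m)) ⟩
      (jump k + i % m) % m          ≡⟨ cong (λ x → (jump k + x) % m) (sym (toℕ-mod i)) ⟩
      (jump k + toℕ (i mod m)) % m  ≡⟨ cong (_% m) (+-comm (jump k) _) ⟩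
      (toℕ (i mod m) + jump k) % m  ∎

  edge⁻¹ : ∀ {j j′} ((k , _) : KnödelEdge 4 n j j′) → toℕ j′ % m ≡ (jump k + toℕ j) % m
  edge⁻¹ {j} {j′} (k , eq) = begin
    toℕ j′ % m                 ≡⟨ toℕ-% j′ ⟩
    toℕ j′                     ≡⟨ eq ⟩
    (toℕ j + jump k) % m       ≡⟨ cong (_% m) (+-comm (toℕ j) (jump k)) ⟩
    (jump k + toℕ j) % m       ∎
    where open ≡-Reasoning

  occurs : List V → V → ℕ
  occurs D v with v ∈? D
  ... | yes _ = 1
  ... | no  _ = 0

  occurs>0 : ∀ {D v} → v ∈ D → 0 < occurs D v
  occurs>0 {D} {v} v∈D with v ∈? D
  ... | yes _   = z<s
  ... | no  v∉D = contradiction v∈D v∉D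

  occurs≤1 : ∀ D v → occurs D v ≤ 1
  occurs≤1 D v with v ∈? D
  ... | yes _ = ≤-refl
  ... | no  _ = z≤n

  occurs-∷ : ∀ x D v → occurs (x ∷ D) v ≤ occurs (x ∷ []) v + occurs D v
  occurs-∷ x D v with v ∈? (x ∷ D)
  ... | no  _           = z≤n
  ... | yes (here eq)   = ≤-trans (occurs>0 {x ∷ []} (here eq)) (m≤m+n _ _)
  ... | yes (there v∈D) = ≤-trans (occurs>0 {D} v∈D) (m≤n+m _ (occurs (x ∷ []) v))

  occurs-single : ∀ {x v} → 0 < occurs (x ∷ []) v → v ≡ x
  occurs-single {x} {v} lt with v ∈? (x ∷ [])
  ... | yes (here eq) = eq

  χ⟨_⟩ : List V → Fin 2 → ℕ → ℕ
  χ⟨ D ⟩ s i = occurs D (vertex s i)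

  side≤1 : ∀ x s → ∑ m (χ⟨ x ∷ [] ⟩ s) ≤ 1
  side≤1 x s = ≮⇒≥ λ two →
    let i , j , i<j , j<m , 0<i , 0<j = ∑>1 m _ (λ i → occurs≤1 (x ∷ []) (vertex s i)) two
    in <⇒≢ i<j (vertex-injective (<-trans i<j j<m) j<m (trans (occurs-single 0<i) (sym (occurs-single 0<j))))

  total-single : ∀ x → ∑ m (χ⟨ x ∷ [] ⟩ 0F) + ∑ m (χ⟨ x ∷ [] ⟩ 1F) ≤ 1
  total-single x with 0 <? ∑ m (χ⟨ x ∷ [] ⟩ 0F) | 0 <? ∑ m (χ⟨ x ∷ [] ⟩ 1F)
  ... | no none | _       = +-mono-≤ (≮⇒≥ none) (side≤1 x 1F)
  ... | yes _   | no none = ≤-trans (+-mono-≤ (side≤1 x 0F) (≮⇒≥ none)) (≤-reflexive (+-identityʳ 1))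
  ... | yes p   | yes q   =
    let _ , _ , 0<i = ∑>0 m _ p
        _ , _ , 0<j = ∑>0 m _ q
    in contradiction (cong proj₁ (trans (occurs-single 0<i) (sym (occurs-single 0<j)))) λ ()

  -- Only an inequality, as `D` may repeat vertices; a lower bound on its length needs no more.
  total : ∀ D → ∑ m (χ⟨ D ⟩ 0F) + ∑ m (χ⟨ D ⟩ 1F) ≤ length D
  total [] = ≤-reflexive (cong₂ _+_ (trans (∑-const m 0) (*-zeroʳ m)) (trans (∑-const m 0) (*-zeroʳ m)))
  total (x ∷ D) = begin
    ∑ m (χ⟨ x ∷ D ⟩ 0F) + ∑ m (χ⟨ x ∷ D ⟩ 1F)
      ≤⟨ +-mono-≤ (split 0F) (split 1F) ⟩
    ∑ m (χ⟨ x ∷ [] ⟩ 0F) + ∑ m (χ⟨ D ⟩ 0F) + (∑ m (χ⟨ x ∷ [] ⟩ 1F) + ∑ m (χ⟨ D ⟩ 1F))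
      ≡⟨ interchange (∑ m (χ⟨ x ∷ [] ⟩ 0F)) _ _ _ ⟩
    ∑ m (χ⟨ x ∷ [] ⟩ 0F) + ∑ m (χ⟨ x ∷ [] ⟩ 1F) + (∑ m (χ⟨ D ⟩ 0F) + ∑ m (χ⟨ D ⟩ 1F))
      ≤⟨ +-mono-≤ (total-single x) (total D) ⟩
    suc (length D) ∎
    where
    open ≤-Reasoning
    split : ∀ s → ∑ m (χ⟨ x ∷ D ⟩ s) ≤ ∑ m (χ⟨ x ∷ [] ⟩ s) + ∑ m (χ⟨ D ⟩ s)
    split s = ≤-trans (∑-mono m (λ {i} _ → occurs-∷ x D (vertex s i)))
                      (≤-reflexive (∑-+ m (χ⟨ x ∷ [] ⟩ s) (χ⟨ D ⟩ s)))

  jump∈reach₀ : ∀ k → (1F , jump k) ∈ reach 0F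
  jump∈reach₀ 0F = there (here refl)
  jump∈reach₀ 1F = there (there (here refl))
  jump∈reach₀ 2F = there (there (there (here refl)))
  jump∈reach₀ 3F = there (there (there (there (here refl))))

  jump∈reach₁ : ∀ k → (0F , 7 ∸ jump k) ∈ reach 1F
  jump∈reach₁ 0F = there (here refl)
  jump∈reach₁ 1F = there (there (here refl))
  jump∈reach₁ 2F = there (there (there (here refl)))
  jump∈reach₁ 3F = there (there (there (there (here refl))))

  jump≤7 : ∀ k → jump k + (7 ∸ jump k) ≡ 7
  jump≤7 0F = refl
  jump≤7 1F = refl
  jump≤7 2F = refl
  jump≤7 3F = refl

  covered⇒coverage₀ : ∀ {D i} → Covered G D (vertex 0F i) → 0 < coverage χ⟨ D ⟩ 0F i
  covered⇒coverage₀ {D} {i} (inj₁ v∈D) =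
    sum-map>0 {f = λ (t , d) → χ⟨ D ⟩ t (d + i)} {xs = reach 0F} (here refl) (occurs>0 {D} v∈D)
  covered⇒coverage₀ {D} {i} (inj₂ ((0F , _) , _ , ()))
  covered⇒coverage₀ {D} {i} (inj₂ ((1F , j) , w∈D , adj@(k , _))) =
    sum-map>0 {f = λ (t , d) → χ⟨ D ⟩ t (d + i)} {xs = reach 0F} (jump∈reach₀ k)
      (occurs>0 {D} (subst (_∈ D) (vertex-≡ 1F (jump k + i) j position) w∈D))
    where
    open ≡-Reasoning
    position : (jump k + i) % m ≡ toℕ j
    position = begin
      (jump k + i) % m             ≡⟨ +-cong-% m (jump k) (sym (m%n%n≡m%n i m)) ⟩
      (jump k + i % m) % m         ≡⟨ cong (λ x → (jump k + x) % m) (sym (toℕ-mod i)) ⟩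
      (jump k + toℕ (i mod m)) % m ≡⟨ sym (edge⁻¹ adj) ⟩
      toℕ j % m                    ≡⟨ toℕ-% j ⟩
      toℕ j                        ∎

  covered⇒coverage₁ : ∀ {D i} → Covered G D (vertex 1F (7 + i)) → 0 < coverage χ⟨ D ⟩ 1F i
  covered⇒coverage₁ {D} {i} (inj₁ v∈D) =
    sum-map>0 {f = λ (t , d) → χ⟨ D ⟩ t (d + i)} {xs = reach 1F} (here refl) (occurs>0 {D} v∈D)
  covered⇒coverage₁ {D} {i} (inj₂ ((1F , _) , _ , ()))
  covered⇒coverage₁ {D} {i} (inj₂ ((0F , j) , w∈D , adj@(k , _))) =
    sum-map>0 {f = λ (t , d) → χ⟨ D ⟩ t (d + i)} {xs = reach 1F} (jump∈reach₁ k)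
      (occurs>0 {D} (subst (_∈ D) (vertex-≡ 0F (7 ∸ jump k + i) j position) w∈D))
    where
    open ≡-Reasoning
    position : (7 ∸ jump k + i) % m ≡ toℕ j
    position = trans (+-cancel-% m (jump k) (begin
      (jump k + (7 ∸ jump k + i)) % m ≡⟨ cong (_% m) (sym (+-assoc (jump k) _ i)) ⟩
      (jump k + (7 ∸ jump k) + i) % m ≡⟨ cong (λ x → (x + i) % m) (jump≤7 k) ⟩
      (7 + i) % m                     ≡⟨ sym (m%n%n≡m%n (7 + i) m) ⟩
      (7 + i) % m % m                 ≡⟨ cong (_% m) (sym (toℕ-mod (7 + i))) ⟩
      toℕ ((7 + i) mod m) % m         ≡⟨ edge⁻¹ adj ⟩
      (jump k + toℕ j) % m            ∎)) (toℕ-% j)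

  configuration : ∀ {κ} D → (∀ j → Covered G D (1F , j)) →
    ∑ m (λ i → 1 ∸ coverage χ⟨ D ⟩ 0F i) ≤ κ →
    ∃₂ λ a b → Configuration m a b κ × a + b ≤ length D
  configuration D covers holes = _ , _ , record
    { χ        = χ⟨ D ⟩
    ; periodic = λ s i → cong (occurs D) (vertex-cong s ([m+n]%n≡m%n i m))
    ; bit      = λ s i → occurs≤1 D (vertex s i)
    ; total₀   = refl
    ; total₁   = refl
    ; holes    = holes
    ; second   = λ i → >⇒≢ (covered⇒coverage₁ {D} {i} (covers _))
    } , total D

-- Dominating sets as cyclic words, and automorphisms.

-- At position i, `A` stands for vertex i of part 1 and `B` for vertex i of part 2; the sets built
-- below never contain both.
data Letter : Set where
  ∅ A B : Letter

letter : Fin 2 → Letter → Bool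
letter 0F A = true
letter 1F B = true
letter _  _ = false

nth : List Letter → ℕ → Letter
nth []      i       = ∅
nth (x ∷ w) zero    = x
nth (x ∷ w) (suc i) = nth w i

some : (ℕ → Letter) → List (Fin 2 × ℕ) → Bool
some f []             = false
some f ((t , d) ∷ ds) = letter t (f d) ∨ some f ds

fine : Fin 2 → (ℕ → Letter) → Bool
fine s f = some f (reach s)

-- It consumes the word from the front, so that it evaluates on a known prefix followed by a
-- symbolic number of blocks.
allFine : ℕ → List Letter → Bool
allFine zero    w = true
allFine (suc k) w = fine 0F (nth w) ∧ fine 1F (nth w) ∧ allFine k (drop 1 w)

-- Seven is the largest offset in `reach`; with seven letters repeated at the end, every test reads
-- straight ahead.
cyclicWord : List Letter → List Letter
cyclicWord w = w ++ take 7 w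

-- In near words position 0 of part 1 is the vertex left undominated.
full near : List Letter → Bool
full w = allFine (length w) (cyclicWord w)
near w = fine 1F (nth (cyclicWord w)) ∧ allFine (pred (length w)) (drop 1 (cyclicWord w))

weight : List Letter → ℕ
weight []      = 0
weight (∅ ∷ w) = weight w
weight (A ∷ w) = suc (weight w)
weight (B ∷ w) = suc (weight w)

some-true : ∀ f ds → some f ds ≡ true → ∃₂ λ t d → (t , d) ∈ ds × letter t (f d) ≡ true
some-true f ((t , d) ∷ ds) ok with letter t (f d) in eq
... | true  = t , d , here refl , eq
... | false = let t′ , d′ , ∈ds , eq′ = some-true f ds ok in t′ , d′ , there ∈ds , eq′

nth-drop : ∀ w i → nth (drop 1 w) i ≡ nth w (suc i)
nth-drop []      i = refl
nth-drop (x ∷ w) i = refl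

some-cong : ∀ {f g} → (∀ i → f i ≡ g i) → ∀ ds → some f ds ≡ some g ds
some-cong f≗g []             = refl
some-cong f≗g ((t , d) ∷ ds) = cong₂ (λ x b → letter t x ∨ b) (f≗g d) (some-cong f≗g ds)

allFine-suc : ∀ k w → allFine (suc k) w ≡ true → (∀ s → fine s (nth w) ≡ true) × allFine k (drop 1 w) ≡ true
allFine-suc k w ok with ∧-true {fine 0F (nth w)} ok
... | ok₀ , ok′ with ∧-true {fine 1F (nth w)} ok′
...   | ok₁ , rest = (λ { 0F → ok₀ ; 1F → ok₁ }) , rest

allFine-sound : ∀ k w {i} → allFine k w ≡ true → i < k → ∀ s → fine s (λ d → nth w (d + i)) ≡ true
allFine-sound (suc k) w {zero} ok _ s =
  trans (some-cong (λ d → cong (nth w) (+-identityʳ d)) (reach s)) (proj₁ (allFine-suc k w ok) s)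
allFine-sound (suc k) w {suc i} ok (s≤s i<k) s =
  trans (some-cong (λ d → trans (cong (nth w) (+-suc d i)) (sym (nth-drop w (d + i)))) (reach s))
        (allFine-sound k (drop 1 w) (proj₂ (allFine-suc k w ok)) i<k s)

nth-++ˡ : ∀ w w′ {i} → i < length w → nth (w ++ w′) i ≡ nth w i
nth-++ˡ (x ∷ w) w′ {zero}  _         = refl
nth-++ˡ (x ∷ w) w′ {suc i} (s≤s i<l) = nth-++ˡ w w′ i<l

nth-++ʳ : ∀ w w′ i → nth (w ++ w′) (length w + i) ≡ nth w′ i
nth-++ʳ []      w′ i = refl
nth-++ʳ (x ∷ w) w′ i = nth-++ʳ w w′ i

nth-take : ∀ k w {i} → i < k → nth (take k w) i ≡ nth w i
nth-take (suc k) []      _         = refl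
nth-take (suc k) (x ∷ w) {zero}  _ = refl
nth-take (suc k) (x ∷ w) {suc i} (s≤s i<k) = nth-take k w i<k

nth-cyclic : ∀ w .{{_ : NonZero (length w)}} {i} → 7 ≤ length w → i < length w + 7 →
             nth (cyclicWord w) i ≡ nth w (i % length w)
nth-cyclic w {i} 7≤l i< with i <? length w
... | yes i<l = trans (nth-++ˡ w (take 7 w) i<l) (cong (nth w) (sym (m<n⇒m%n≡m i<l)))
... | no  i≮l = begin
  nth (cyclicWord w) i       ≡⟨ cong (nth (cyclicWord w)) (sym (m+[n∸m]≡n (≮⇒≥ i≮l))) ⟩
  nth (cyclicWord w) (length w + j) ≡⟨ nth-++ʳ w (take 7 w) j ⟩
  nth (take 7 w) j           ≡⟨ nth-take 7 w j<7 ⟩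
  nth w j                    ≡⟨ cong (nth w) (sym (m<n⇒m%n≡m (<-≤-trans j<7 7≤l))) ⟩
  nth w (j % length w)       ≡⟨ cong (nth w) (sym ([m+n]%n≡m%n j (length w))) ⟩
  nth w ((j + length w) % length w) ≡⟨ cong (λ x → nth w (x % length w)) (m∸n+n≡m (≮⇒≥ i≮l)) ⟩
  nth w (i % length w)       ∎
  where
  open ≡-Reasoning
  j = i ∸ length w
  j<7 : j < 7
  j<7 = +-cancelˡ-< (length w) _ _ (≤-<-trans (≤-reflexive (m+[n∸m]≡n (≮⇒≥ i≮l))) i<)

reach≤7 : ∀ s {t d} → (t , d) ∈ reach s → d ≤ 7
reach≤7 0F (here refl) = z≤n
reach≤7 0F (there (here refl)) = z≤n
reach≤7 0F (there (there (here refl))) = m≤m+n 1 6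
reach≤7 0F (there (there (there (here refl)))) = m≤m+n 3 4
reach≤7 0F (there (there (there (there (here refl))))) = ≤-refl
reach≤7 1F (here refl) = ≤-refl
reach≤7 1F (there (here refl)) = ≤-refl
reach≤7 1F (there (there (here refl))) = m≤m+n 6 1
reach≤7 1F (there (there (there (here refl)))) = m≤m+n 4 3
reach≤7 1F (there (there (there (there (here refl))))) = z≤n

module Construction (n : ℕ) .{{_ : NonZero (n / 2)}} where
  open Knödel n

  place : ℕ → List Letter → List V
  place k []      = []
  place k (∅ ∷ w) = place (suc k) w
  place k (A ∷ w) = vertex 0F k ∷ place (suc k) w
  place k (B ∷ w) = vertex 1F k ∷ place (suc k) w

  length-place : ∀ k w → length (place k w) ≡ weight w
  length-place k []      = refl
  length-place k (∅ ∷ w) = length-place (suc k) w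
  length-place k (A ∷ w) = cong suc (length-place (suc k) w)
  length-place k (B ∷ w) = cong suc (length-place (suc k) w)

  ∈-place : ∀ k w i t → letter t (nth w i) ≡ true → vertex t (k + i) ∈ place k w
  ∈-place k []      i       0F ()
  ∈-place k []      i       1F ()
  ∈-place k (∅ ∷ w) zero    0F ()
  ∈-place k (∅ ∷ w) zero    1F ()
  ∈-place k (A ∷ w) zero    1F ()
  ∈-place k (B ∷ w) zero    0F ()
  ∈-place k (A ∷ w) zero    0F refl = here (cong (vertex 0F) (+-identityʳ k))
  ∈-place k (B ∷ w) zero    1F refl = here (cong (vertex 1F) (+-identityʳ k))
  ∈-place k (∅ ∷ w) (suc i) t eq = subst (λ j → vertex t j ∈ place (suc k) w) (sym (+-suc k i)) (∈-place (suc k) w i t eq)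
  ∈-place k (A ∷ w) (suc i) t eq = there (subst (λ j → vertex t j ∈ place (suc k) w) (sym (+-suc k i)) (∈-place (suc k) w i t eq))
  ∈-place k (B ∷ w) (suc i) t eq = there (subst (λ j → vertex t j ∈ place (suc k) w) (sym (+-suc k i)) (∈-place (suc k) w i t eq))

  base : Fin 2 → ℕ
  base 0F = 0
  base 1F = 7

  reach-closed : ∀ s i {t d} → (t , d) ∈ reach s →
                 vertex t (d + i) ≡ vertex s (base s + i) ⊎ KnödelAdj 4 n (vertex s (base s + i)) (vertex t (d + i))
  reach-closed 0F i (here refl)                                 = inj₁ refl
  reach-closed 0F i (there (here refl))                         = inj₂ (edge 0F refl)
  reach-closed 0F i (there (there (here refl)))                 = inj₂ (edge 1F refl)
  reach-closed 0F i (there (there (there (here refl))))         = inj₂ (edge 2F refl)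
  reach-closed 0F i (there (there (there (there (here refl))))) = inj₂ (edge 3F refl)
  reach-closed 1F i (here refl)                                 = inj₁ refl
  reach-closed 1F i (there (here refl))                         = inj₂ (edge 0F refl)
  reach-closed 1F i (there (there (here refl)))                 = inj₂ (edge 1F refl)
  reach-closed 1F i (there (there (there (here refl))))         = inj₂ (edge 2F refl)
  reach-closed 1F i (there (there (there (there (here refl))))) = inj₂ (edge 3F refl)

  module _ (w : List Letter) (l≡m : length w ≡ m) (7≤m : 7 ≤ m) where

    fine⇒covered : ∀ s {i} → i < m → fine s (λ d → nth (cyclicWord w) (d + i)) ≡ true →
                   Covered G (place 0 w) (vertex s (base s + i))
    fine⇒covered s {i} i<m ok with some-true _ (reach s) ok
    ... | t , d , ∈reach , marked = conclude (reach-closed s i ∈reach)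
      where
      instance
        nonZeroLength : NonZero (length w)
        nonZeroLength = >-nonZero (≤-trans (m≤m+n 1 6) (≤-trans 7≤m (≤-reflexive (sym l≡m))))

      d+i<l+7 : d + i < length w + 7
      d+i<l+7 = ≤-trans (+-mono-≤-< (reach≤7 s ∈reach) i<m) (≤-reflexive (trans (+-comm 7 m) (cong (_+ 7) (sym l≡m))))

      placed : vertex t (d + i) ∈ place 0 w
      placed = subst (_∈ place 0 w)
        (vertex-cong t (trans (cong (_% m) (%-congʳ l≡m)) (m%n%n≡m%n (d + i) m)))
        (∈-place 0 w ((d + i) % length w) t (trans
          (cong (letter t) (sym (nth-cyclic w (≤-trans 7≤m (≤-reflexive (sym l≡m))) d+i<l+7))) marked))

      conclude : vertex t (d + i) ≡ vertex s (base s + i) ⊎ KnödelAdj 4 n (vertex s (base s + i)) (vertex t (d + i)) →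
                 Covered G (place 0 w) (vertex s (base s + i))
      conclude (inj₁ eq)  = inj₁ (subst (_∈ place 0 w) eq placed)
      conclude (inj₂ adj) = inj₂ (vertex t (d + i) , placed , adj)

    locate : ∀ s j → ∃[ i ] (i < m × vertex s (base s + i) ≡ (s , j))
    locate 0F j = toℕ j , toℕ<n j , vertex-toℕ 0F j
    -- The test at word position i concerns vertex 7 + i of part 2, so j is found seven places
    -- earlier on the cycle.
    locate 1F j = (toℕ j + (m ∸ 7)) % m , m%n<n _ m , trans (vertex-cong 1F same) (vertex-toℕ 1F j)
      where
      open ≡-Reasoning
      same : (7 + (toℕ j + (m ∸ 7)) % m) % m ≡ toℕ j % m
      same = begin
        (7 + (toℕ j + (m ∸ 7)) % m) % m ≡⟨ +-cong-% m 7 (m%n%n≡m%n (toℕ j + (m ∸ 7)) m) ⟩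
        (7 + (toℕ j + (m ∸ 7))) % m     ≡⟨ cong (_% m) (x∙yz≈y∙xz 7 (toℕ j) (m ∸ 7)) ⟩
        (toℕ j + (7 + (m ∸ 7))) % m     ≡⟨ cong (λ x → (toℕ j + x) % m) (m+[n∸m]≡n 7≤m) ⟩
        (toℕ j + m) % m                 ≡⟨ [m+n]%n≡m%n (toℕ j) m ⟩
        toℕ j % m                       ∎

    full-covers : full w ≡ true → ∀ v → Covered G (place 0 w) v
    full-covers ok (s , j) with locate s j
    ... | i , i<m , refl = fine⇒covered s i<m
            (allFine-sound (length w) (cyclicWord w) ok (≤-trans i<m (≤-reflexive (sym l≡m))) s)

    near-covers : near w ≡ true → CoversExcept G (vertex 0F 0) (place 0 w)
    near-covers ok (s , j) v≢u with locate s j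
    ... | suc i , i<m , refl = fine⇒covered s i<m
            (trans (some-cong (λ d → trans (cong (nth (cyclicWord w)) (+-suc d i)) (sym (nth-drop (cyclicWord w) (d + i)))) (reach s))
              (allFine-sound (pred (length w)) (drop 1 (cyclicWord w)) (proj₂ (∧-true {fine 1F (nth (cyclicWord w))} ok))
                (≤-trans (<⇒<pred i<m) (≤-reflexive (cong pred (sym l≡m)))) s))
      where
      <⇒<pred : ∀ {i m} → suc i < m → i < pred m
      <⇒<pred (s≤s p) = p
    near-covers ok (0F , j) v≢u | zero , i<m , refl = contradiction refl v≢u
    near-covers ok (1F , j) v≢u | zero , i<m , refl = fine⇒covered 1F i<m
            (trans (some-cong (λ d → cong (nth (cyclicWord w)) (+-identityʳ d)) (reach 1F)) (proj₁ (∧-true {fine 1F (nth (cyclicWord w))} ok)))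

  -- A right inverse of `f` is enough: it gives each v a preimage, which differs from `u` when v
  -- differs from `f u`.
  transport : ∀ (f g : V → V) → (∀ v → f (g v) ≡ v) → (∀ {v w} → Adj G v w → Adj G (f v) (f w)) →
              ∀ {u D} → CoversExcept G u D → CoversExcept G (f u) (map f D)
  transport f g f∘g adj⁺ {u} {D} covers v v≢fu =
    subst (Covered G (map f D)) (f∘g v) (image (covers (g v) λ gv≡u → v≢fu (trans (sym (f∘g v)) (cong f gv≡u))))
    where
    image : ∀ {v} → Covered G D v → Covered G (map f D) (f v)
    image (inj₁ v∈D)             = inj₁ (∈-map⁺ f v∈D)
    image (inj₂ (w , w∈D , adj)) = inj₂ (f w , ∈-map⁺ f w∈D , adj⁺ adj)

  translate : ℕ → V → V
  translate c (s , j) = vertex s (c + toℕ j)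

  translate-vertex : ∀ c s i → translate c (vertex s i) ≡ vertex s (c + i)
  translate-vertex c s i = vertex-cong s (trans (cong (λ x → (c + x) % m) (toℕ-mod i)) (+-cong-% m c (m%n%n≡m%n i m)))

  translate-inverse : ∀ c v → translate c (translate (c * m ∸ c) v) ≡ v
  translate-inverse c (s , j) = begin
    translate c (vertex s (c * m ∸ c + toℕ j)) ≡⟨ translate-vertex c s _ ⟩
    vertex s (c + (c * m ∸ c + toℕ j))         ≡⟨ cong (vertex s) (sym (+-assoc c _ _)) ⟩
    vertex s (c + (c * m ∸ c) + toℕ j)         ≡⟨ cong (λ x → vertex s (x + toℕ j)) (m+[n∸m]≡n (m≤m*n c m)) ⟩
    vertex s (c * m + toℕ j)                   ≡⟨ vertex-cong s (%-remove-+ˡ (toℕ j) (divides c refl)) ⟩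
    vertex s (toℕ j)                           ≡⟨ vertex-toℕ s j ⟩
    (s , j)                                    ∎
    where open ≡-Reasoning

  translate-adj : ∀ c {v w} → Adj G v w → Adj G (translate c v) (translate c w)
  translate-adj c {0F , j} {1F , j′} e@(k , _) = edge k (translate-edge c j j′ k (edge⁻¹ e))
    where
    translate-edge : ∀ c j j′ k → toℕ j′ % m ≡ (jump k + toℕ j) % m → (c + toℕ j′) % m ≡ (jump k + (c + toℕ j)) % m
    translate-edge c j j′ k eq = trans (+-cong-% m c eq) (cong (_% m) (x∙yz≈y∙xz c (jump k) (toℕ j)))
  translate-adj c {0F , _} {0F , _} ()
  translate-adj c {1F , _} {1F , _} ()
  translate-adj c {1F , j′} {0F , j} e = translate-adj c {0F , j} {1F , j′} e

  reflect : V → V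
  reflect (0F , j) = vertex 1F (m ∸ toℕ j)
  reflect (1F , j) = vertex 0F (m ∸ toℕ j)

  reflect-twice : ∀ (j : Fin m) → (m ∸ toℕ ((m ∸ toℕ j) mod m)) % m ≡ toℕ j % m
  reflect-twice j = +-cancel-% m y (begin
    (y + (m ∸ y)) % m             ≡⟨ cong (_% m) (m+[n∸m]≡n (<⇒≤ (toℕ<n ((m ∸ toℕ j) mod m)))) ⟩
    m % m                         ≡⟨ cong (_% m) (sym (m+[n∸m]≡n (<⇒≤ (toℕ<n j)))) ⟩
    (toℕ j + (m ∸ toℕ j)) % m     ≡⟨ +-cong-% m (toℕ j) (sym (m%n%n≡m%n (m ∸ toℕ j) m)) ⟩
    (toℕ j + (m ∸ toℕ j) % m) % m ≡⟨ cong (λ x → (toℕ j + x) % m) (sym (toℕ-mod (m ∸ toℕ j))) ⟩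
    (toℕ j + y) % m               ≡⟨ cong (_% m) (+-comm (toℕ j) y) ⟩
    (y + toℕ j) % m               ∎)
    where
    open ≡-Reasoning
    y = toℕ ((m ∸ toℕ j) mod m)

  reflect-involutive : ∀ v → reflect (reflect v) ≡ v
  reflect-involutive (0F , j) = trans (vertex-cong 0F (reflect-twice j)) (vertex-toℕ 0F j)
  reflect-involutive (1F , j) = trans (vertex-cong 1F (reflect-twice j)) (vertex-toℕ 1F j)

  reflect-adj : ∀ {v w} → Adj G v w → Adj G (reflect v) (reflect w)
  -- Adding j + j′ to both sides clears the two negated indices.
  reflect-adj {0F , j} {1F , j′} e@(k , _) = edge k (+-cancel-% m (toℕ j + toℕ j′) (begin
    (toℕ j + toℕ j′ + (m ∸ toℕ j)) % m             ≡⟨ cong (_% m) (rearrange₁ (toℕ j) (toℕ j′) (m ∸ toℕ j)) ⟩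
    (toℕ j′ + (toℕ j + (m ∸ toℕ j))) % m           ≡⟨ cong (λ x → (toℕ j′ + x) % m) (m+[n∸m]≡n (<⇒≤ (toℕ<n j))) ⟩
    (toℕ j′ + m) % m                               ≡⟨ [m+n]%n≡m%n (toℕ j′) m ⟩
    toℕ j′ % m                                     ≡⟨ edge⁻¹ e ⟩
    (jump k + toℕ j) % m                           ≡⟨ sym ([m+n]%n≡m%n (jump k + toℕ j) m) ⟩
    (jump k + toℕ j + m) % m                       ≡⟨ cong (λ x → (jump k + toℕ j + x) % m) (sym (m+[n∸m]≡n (<⇒≤ (toℕ<n j′)))) ⟩
    (jump k + toℕ j + (toℕ j′ + (m ∸ toℕ j′))) % m ≡⟨ cong (_% m) (rearrange₂ (jump k) (toℕ j) (toℕ j′) (m ∸ toℕ j′)) ⟩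
    (toℕ j + toℕ j′ + (jump k + (m ∸ toℕ j′))) % m ∎))
    where
    open ≡-Reasoning
    rearrange₁ : ∀ x y z → x + y + z ≡ y + (x + z)
    rearrange₁ = solve-∀
    rearrange₂ : ∀ c x y z → c + x + (y + z) ≡ x + y + (c + z)
    rearrange₂ = solve-∀
  reflect-adj {0F , _} {0F , _} ()
  reflect-adj {1F , _} {1F , _} ()
  reflect-adj {1F , j′} {0F , j} e = reflect-adj {0F , j} {1F , j′} e

  coversExcept-everywhere : ∀ {D} → CoversExcept G (vertex 0F 0) D →
                            ∀ u → ∃[ E ] (length E ≡ length D × CoversExcept G u E)
  coversExcept-everywhere {D} covers = everywhere
    where
    first : ∀ j → ∃[ E ] (length E ≡ length D × CoversExcept G (0F , j) E)
    first j = map (translate (toℕ j)) D , length-map _ D ,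
      subst (λ u → CoversExcept G u (map (translate (toℕ j)) D))
        (trans (translate-vertex (toℕ j) 0F 0) (trans (cong (vertex 0F) (+-identityʳ (toℕ j))) (vertex-toℕ 0F j)))
        (transport (translate (toℕ j)) (translate (toℕ j * m ∸ toℕ j)) (translate-inverse (toℕ j))
          (λ {v} {w} → translate-adj (toℕ j) {v} {w}) covers)

    everywhere : ∀ u → ∃[ E ] (length E ≡ length D × CoversExcept G u E)
    everywhere (0F , j) = first j
    -- The vertex is reflected into part 1, and the set found there is reflected back.
    everywhere (1F , j) =
      let E , eq , E-covers = first (proj₂ (reflect (1F , j)))
      in map reflect E , trans (length-map reflect E) eq ,
         subst (λ u → CoversExcept G u (map reflect E)) (reflect-involutive (1F , j))
           (transport reflect reflect reflect-involutive (λ {v} {w} → reflect-adj {v} {w}) E-covers)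

  covers⇒length : ∀ {k} → (∀ {a b} → Configuration m a b 0 → k ≤ a + b) →
                  ∀ D → (∀ v → Covered G D v) → k ≤ length D
  covers⇒length bound D covers =
    let _ , _ , C , a+b≤ = configuration D (λ j → covers (1F , j)) no-holes
    in ≤-trans (bound C) a+b≤
    where
    no-holes : ∑ m (λ i → 1 ∸ coverage χ⟨ D ⟩ 0F i) ≤ 0
    no-holes = ≤-trans (∑-mono m {g = λ _ → 0} λ {i} _ → m≤n⇒m∸n≡0′ (covered⇒coverage₀ {D} {i} (covers _)))
                       (≤-reflexive (trans (∑-const m 0) (*-zeroʳ m)))
      where
      m≤n⇒m∸n≡0′ : ∀ {c} → 0 < c → 1 ∸ c ≤ 0
      m≤n⇒m∸n≡0′ p = ≤-reflexive (m≤n⇒m∸n≡0 p)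

  coversExcept⇒length : ∀ {k} → (∀ {a b} → Configuration m a b 1 → k ≤ a + b) →
                        ∀ D → CoversExcept G (vertex 0F 0) D → k ≤ length D
  coversExcept⇒length bound D covers =
    let _ , _ , C , a+b≤ = configuration D (λ j → covers (1F , j) λ ()) one-hole
    in ≤-trans (bound C) a+b≤
    where
    hole : ∀ {i} → 0 < 1 ∸ coverage χ⟨ D ⟩ 0F i → vertex 0F i ≡ vertex 0F 0
    hole {i} p with vertex 0F i ≟ᵛ vertex 0F 0
    ... | yes eq = eq
    ... | no  ≢u = contradiction (≤-trans p (≤-reflexive (m≤n⇒m∸n≡0 (covered⇒coverage₀ {D} {i} (covers _ ≢u))))) λ ()

    one-hole : ∑ m (λ i → 1 ∸ coverage χ⟨ D ⟩ 0F i) ≤ 1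
    one-hole = ≮⇒≥ λ two →
      let i , j , i<j , j<m , 0<i , 0<j = ∑>1 m _ (λ i → m∸n≤m 1 (coverage χ⟨ D ⟩ 0F i)) two
      in <⇒≢ i<j (vertex-injective (<-trans i<j j<m) j<m (trans (hole {i} 0<i) (sym (hole {j} 0<j))))

-- Periodic words with a bounded defect.

-- Repeated alone, A∅∅∅B dominates every vertex exactly once.
blocks : ℕ → List Letter → List Letter
blocks zero    z = z
blocks (suc q) z = A ∷ ∅ ∷ ∅ ∷ ∅ ∷ B ∷ blocks q z

length-blocks : ∀ q z → length (blocks q z) ≡ length z + q * 5
length-blocks zero    z = sym (+-identityʳ _)
length-blocks (suc q) z = trans (cong (5 +_) (length-blocks q z)) (x∙yz≈y∙xz 5 (length z) (q * 5))

weight-blocks : ∀ q z → weight (blocks q z) ≡ weight z + q * 2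
weight-blocks zero    z = sym (+-identityʳ _)
weight-blocks (suc q) z = trans (cong (2 +_) (weight-blocks q z)) (x∙yz≈y∙xz 2 (weight z) (q * 2))

-- The tests on the first block read at most twelve letters, all known when two more blocks follow.
-- They evaluate away and leave the claim for one block fewer, with the same seven letters wrapped
-- round.
full-0 : ∀ q → full (blocks (2 + q) []) ≡ true
full-0 zero    = refl
full-0 (suc q) = full-0 q

full-2 : ∀ q → full (blocks (2 + q) (B ∷ A ∷ [])) ≡ true
full-2 zero    = refl
full-2 (suc q) = full-2 q

full-3 : ∀ q → full (blocks (2 + q) (B ∷ A ∷ A ∷ [])) ≡ true
full-3 zero    = refl
full-3 (suc q) = full-3 q

-- For r = 1 with t = q + 1 and for r = 4 with t = q; the weights 2t+1 and 2t+3 are one less than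
-- full domination requires in the cases where they are used.
word₁ word₄ : ℕ → List Letter
word₁ q = ∅ ∷ ∅ ∷ B ∷ A ∷ blocks q (A ∷ ∅ ∷ [])
word₄ q = ∅ ∷ A ∷ blocks q (B ∷ B ∷ [])

near-1 : ∀ q → near (word₁ (1 + q)) ≡ true
near-1 zero    = refl
-- The tests at the four opening letters read at most eleven letters and evaluate once two blocks
-- are known; with a single block they would read past it, hence the separate base case.
near-1 (suc q) = go q
  where
  go : ∀ q → allFine (length (blocks (2 + q) (A ∷ ∅ ∷ []))) (blocks (2 + q) (A ∷ ∅ ∷ []) ++ take 7 (word₁ (2 + q))) ≡ true
  go zero    = refl
  go (suc q) = go q

near-4 : ∀ q → near (word₄ (2 + q)) ≡ true
near-4 q = go q
  where
  go : ∀ q → allFine (length (blocks (2 + q) (B ∷ B ∷ []))) (blocks (2 + q) (B ∷ B ∷ []) ++ take 7 (word₄ (2 + q))) ≡ true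
  go zero    = refl
  go (suc q) = go q

-- The decision by m modulo five.

CriticalOrder : ℕ → Set
CriticalOrder n = n ≡ 26 ⊎ (22 ≤ n × n % 10 ≡ 2) ⊎ (38 ≤ n × n % 10 ≡ 8)

module Decision (n : ℕ) (8≤m : 8 ≤ n / 2) where

  private
    instance
      nonZeroHalf : NonZero (n / 2)
      nonZeroHalf = >-nonZero (≤-trans (s≤s z≤n) 8≤m)

  open Knödel n
  open Construction n

  private
    7≤m : 7 ≤ m
    7≤m = ≤-trans (n≤1+n 7) 8≤m

  critical : ∀ {k} w g → m ≡ k → length w ≡ k → weight w ≡ g → near w ≡ true →
             (∀ {a b} → Configuration k a b 0 → suc g ≤ a + b) → γ-Critical (W 4 n)
  critical w g refl l≡ weight≡ ok bound = γ-critical {G} _≟ᵛ_ g (covers⇒length bound) λ u →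
    let E , eq , E-covers = coversExcept-everywhere (near-covers w l≡ 7≤m ok) u
    in E , trans eq (trans (length-place 0 w) weight≡) , E-covers

  not-critical : ∀ {k} w g → m ≡ k → length w ≡ k → weight w ≡ g → full w ≡ true →
                 (∀ {a b} → Configuration k a b 1 → g ≤ a + b) → ¬ γ-Critical (W 4 n)
  not-critical w g refl l≡ weight≡ ok bound = ¬γ-critical {G} _≟ᵛ_ (vertex 0F 0) g
    (place 0 w , trans (length-place 0 w) weight≡ , full-covers w l≡ 7≤m ok)
    (coversExcept⇒length bound)

  too-small : ∀ {k} {A : Set} → m ≡ k → k < 8 → A
  too-small refl k<8 = contradiction 8≤m (<⇒≱ k<8)

  Outcome : Set
  Outcome = (γ-Critical (W 4 n) × CriticalOrder n) ⊎ (¬ γ-Critical (W 4 n) × ¬ CriticalOrder n)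

  residue : ∀ r t → n ≡ r * 2 + t * 10 → n % 10 ≡ r * 2 % 10
  residue r t eq = trans (cong (_% 10) eq) ([m+kn]%n≡m%n (r * 2) t 10)

  not-order : ∀ {c} → n % 10 ≡ c → n ≢ 26 → c ≢ 2 → (c ≡ 8 → n < 38) → ¬ CriticalOrder n
  not-order res ≢26 ≢2 <38 (inj₁ eq)               = ≢26 eq
  not-order res ≢26 ≢2 <38 (inj₂ (inj₁ (_ , eq)))  = ≢2 (trans (sym res) eq)
  not-order res ≢26 ≢2 <38 (inj₂ (inj₂ (le , eq))) = <⇒≱ (<38 (trans (sym res) eq)) le

  residue≢6 : ∀ {c} → n % 10 ≡ c → c ≢ 6 → n ≢ 26
  residue≢6 res c≢6 eq = c≢6 (trans (sym res) (cong (_% 10) eq))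

  outcome : ∀ r t → r < 5 → m ≡ r + t * 5 → n ≡ r * 2 + t * 10 → Outcome
  outcome 0 0 _ m≡ n≡ = too-small m≡ numeral
  outcome 0 1 _ m≡ n≡ = too-small m≡ numeral
  outcome 0 (suc (suc k)) _ m≡ n≡ = inj₂
    ( not-critical (blocks (2 + k) []) ((2 + k) * 2) m≡ (length-blocks (2 + k) []) (weight-blocks (2 + k) []) (full-0 k)
        -- A multiple of five is read as remainder 5 with t lowered by one, so that 3 ≤ r holds; the
        -- bound is then exactly the number of chosen vertices.
        (bound-near 5 (1 + k) numeral)
    , not-order (residue 0 (2 + k) n≡) (residue≢6 (residue 0 (2 + k) n≡) λ ()) (λ ()) λ () )
  outcome 1 0 _ m≡ n≡ = too-small m≡ numeral
  outcome 1 1 _ m≡ n≡ = too-small m≡ numeral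
  outcome 1 (suc (suc k)) _ m≡ n≡ = inj₁
    ( critical (word₁ (1 + k)) (1 + (2 + k) * 2) m≡
        (cong (4 +_) (length-blocks (1 + k) (A ∷ ∅ ∷ []))) (cong (2 +_) (weight-blocks (1 + k) (A ∷ ∅ ∷ []))) (near-1 k)
        (bound-full-1 k)
    , inj₂ (inj₁ (≤-trans (m≤m+n 22 (k * 10)) (≤-reflexive (sym n≡)) , residue 1 (2 + k) n≡)) )
  outcome 2 0 _ m≡ n≡ = too-small m≡ numeral
  outcome 2 1 _ m≡ n≡ = too-small m≡ numeral
  outcome 2 (suc (suc k)) _ m≡ n≡ = inj₂
    ( not-critical (blocks (2 + k) (B ∷ A ∷ [])) (2 + (2 + k) * 2) m≡ (length-blocks (2 + k) _) (weight-blocks (2 + k) _) (full-2 k)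
        (bound-near-2 k)
    , not-order (residue 2 (2 + k) n≡) (residue≢6 (residue 2 (2 + k) n≡) λ ()) (λ ()) λ () )
  outcome 3 0 _ m≡ n≡ = too-small m≡ numeral
  outcome 3 1 _ m≡ n≡ = inj₂
    ( not-critical (A ∷ A ∷ ∅ ∷ ∅ ∷ ∅ ∷ B ∷ B ∷ ∅ ∷ []) 4 m≡ refl refl refl (bound-near 3 1 numeral)
    , not-order (residue 3 1 n≡) (λ eq → contradiction (trans (sym eq) n≡) λ ()) (λ ()) λ () )
  -- The exception n = 26: seven vertices are needed, but six suffice after a deletion, a saving
  -- that no other m with r = 3 allows.
  outcome 3 2 _ m≡ n≡ = inj₁
    ( critical (∅ ∷ A ∷ A ∷ ∅ ∷ ∅ ∷ ∅ ∷ A ∷ ∅ ∷ ∅ ∷ ∅ ∷ B ∷ B ∷ B ∷ []) 6 m≡ refl refl refl bound-full-13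
    , inj₁ n≡ )
  outcome 3 3 _ m≡ n≡ = inj₂
    -- The word used for m = 9, written twice; its weight 8 beats the 2t+3 of the larger m with r =
    -- 3.
    ( not-critical (A ∷ A ∷ ∅ ∷ ∅ ∷ ∅ ∷ B ∷ B ∷ ∅ ∷ ∅ ∷ A ∷ A ∷ ∅ ∷ ∅ ∷ ∅ ∷ B ∷ B ∷ ∅ ∷ ∅ ∷ []) 8 m≡ refl refl refl (bound-near 3 3 numeral)
    , not-order (residue 3 3 n≡) (λ eq → contradiction (trans (sym eq) n≡) λ ()) (λ ()) λ () )
  outcome 3 (suc (suc (suc (suc k)))) _ m≡ n≡ = inj₂
    ( not-critical (blocks (4 + k) (B ∷ A ∷ A ∷ [])) (3 + (4 + k) * 2) m≡ (length-blocks (4 + k) _) (weight-blocks (4 + k) _) (full-3 (2 + k))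
        (bound-near-3 k)
    , not-order (residue 3 (4 + k) n≡) (λ eq → contradiction (trans (sym eq) n≡) λ ()) (λ ()) λ () )
  outcome 4 0 _ m≡ n≡ = too-small m≡ numeral
  outcome 4 1 _ m≡ n≡ = inj₂
    ( not-critical (A ∷ A ∷ ∅ ∷ ∅ ∷ ∅ ∷ B ∷ B ∷ ∅ ∷ ∅ ∷ []) 4 m≡ refl refl refl (bound-near 4 1 numeral)
    , not-order (residue 4 1 n≡) (residue≢6 (residue 4 1 n≡) λ ()) (λ ()) (λ _ → ≤-trans (s≤s (≤-reflexive n≡)) numeral) )
  -- Seven vertices dominate everything, one fewer than 2t+4, and seven are still needed with a
  -- hole; so for r = 4 criticality begins only at m = 19.
  outcome 4 2 _ m≡ n≡ = inj₂
    ( not-critical (A ∷ A ∷ A ∷ ∅ ∷ ∅ ∷ ∅ ∷ B ∷ ∅ ∷ ∅ ∷ ∅ ∷ B ∷ B ∷ A ∷ ∅ ∷ []) 7 m≡ refl refl refl bound-near-14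
    , not-order (residue 4 2 n≡) (residue≢6 (residue 4 2 n≡) λ ()) (λ ()) (λ _ → ≤-trans (s≤s (≤-reflexive n≡)) numeral) )
  outcome 4 (suc (suc (suc k))) _ m≡ n≡ = inj₁
    ( critical (word₄ (3 + k)) (3 + (3 + k) * 2) m≡
        (cong (2 +_) (length-blocks (3 + k) (B ∷ B ∷ []))) (cong (1 +_) (weight-blocks (3 + k) (B ∷ B ∷ []))) (near-4 (1 + k))
        (bound-full-4 k)
    , inj₂ (inj₂ (≤-trans (m≤m+n 38 (k * 10)) (≤-reflexive (sym n≡)) , residue 4 (3 + k) n≡)) )
  outcome (suc (suc (suc (suc (suc _))))) _ (s≤s (s≤s (s≤s (s≤s (s≤s ()))))) _ _

theorem4p5 : ∀ (n : ℕ) → 2 ∣ n → 16 ≤ n →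
    γ-Critical (W 4 n) ⇔
    (n ≡ 26 ⊎ (22 ≤ n × n % 10 ≡ 2) ⊎ (38 ≤ n × n % 10 ≡ 8))
theorem4p5 n (divides m n≡m*2) 16≤n = conclude
  (outcome (m % 5) (m / 5) (m%n<n m 5) (trans half (m≡m%n+[m/n]*n m 5)) split)
  where
  half : n / 2 ≡ m
  half = trans (cong (_/ 2) n≡m*2) (m*n/n≡m m 2)

  open Decision n (≤-trans (/-monoˡ-≤ 2 16≤n) ≤-refl)

  split : n ≡ m % 5 * 2 + m / 5 * 10
  split = trans n≡m*2 (trans (cong (_* 2) (m≡m%n+[m/n]*n m 5)) (expand (m % 5) (m / 5)))
    where
    expand : ∀ r t → (r + t * 5) * 2 ≡ r * 2 + t * 10
    expand = solve-∀

  conclude : Outcome → γ-Critical (W 4 n) ⇔ CriticalOrder n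
  conclude (inj₁ (is-critical , order))  = mk⇔ (λ _ → order) (λ _ → is-critical)
  conclude (inj₂ (non-critical , none)) = mk⇔ (λ c → contradiction c non-critical) (λ o → contradiction o none)
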